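{- Let $\Omega$ be an alphabet with $b\geq 2$ symbols and let $x\in\Omega^{\mathbb{N}}$. Fix a positive real number $\lambda$ and define, for every $i\in\mathbb{N}_0$, $p_i=\liminf_{k\to\infty}Z^\lambda_{i,k}(x)$. If $\sum_{i\geq 0} i\,p_i=\lambda$, then $x$ is Borel normal to base $b$.
   Context: Positions in sequences are numbered from $1$; $x[i\dots j]$ is the subword from position $i$ to $j$. For words $v,w$, $|v|_w=\#\{1\leq i\leq |v|-|w|+1 : v[i\dots i+|w|-1]=w\}$. For $x\in\Omega^{\mathbb{N}}$, $\lambda>0$, $i\in\mathbb{N}_0$, $k\in\mathbb{N}$, $Z^\lambda_{i,k}(x)=b^{ -k}\,\#\{w\in\Omega^k : |x[1\dots\lfloor\lambda b^k\rfloor+k-1]|_w=i\}$. A sequence $x\in\Omega^{\mathbb{N}}$ is Borel normal (to base $b$) if for every finite word $w$ over $\Omega$, $\lim_{n\to\infty}|x[1\dots n]|_w/n=b^{ -|w|}$. -}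

module Defs where

open import Algebra.Bundles using (RawMonoid)
import Algebra.Definitions.RawMonoid as RawMonoidDefinitions
open import Data.Fin.Base using (Fin; toℕ)
open import Data.Fin.Properties as Fin using ()
open import Data.Integer.Base using (+_)
open import Data.List.Base as List
  using (List; length; filter; upTo; applyUpTo; take; drop; allFin; cartesianProductWith)
open import Data.List.Properties using (≡-dec)
open import Data.Nat.Base as ℕ
  using (ℕ; zero; suc; _∸_; _^_; _⊔_; NonZero; NonTrivial; nonTrivial⇒nonZero)
import Data.Nat.Properties as ℕ
open import Data.Product.Base using (Σ-syntax; ∃-syntax; _×_; _,_; proj₁; proj₂)
open import Data.Rational.Base as ℚ using (ℚ; 0ℚ; ½)
import Data.Rational.Properties as ℚ
open import Data.Rational.Solver using (module +-*-Solver)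
open import Data.Sum.Base using (inj₁; inj₂)
open import Data.Vec.Base as Vec using (Vec; []; _∷_)
open import Function.Bundles using (_↔_; Inverse)
open import Function.Properties.Inverse using (↔⇒↣)
open import Level using (0ℓ)
open import Relation.Binary.Definitions using (DecidableEquality)
open import Relation.Binary.PropositionalEquality
  using (_≡_; refl; sym; trans; cong; subst; subst₂)
open import Relation.Nullary.Decidable using (via-injection)

-- Real numbers as Cauchy sequences of rationals, compared up to _≈_.

IsCauchy : (ℕ → ℚ) → Set
IsCauchy s = ∀ ε → 0ℚ ℚ.< ε →
  ∃[ N ] (∀ m n → N ℕ.≤ m → N ℕ.≤ n → ℚ.∣ s m ℚ.- s n ∣ ℚ.< ε)

record ℝ : Set where
  constructor mkℝ
  field
    seq    : ℕ → ℚ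
    cauchy : IsCauchy seq

open ℝ public

infix 4 _<_ _≤_ _≈_

_<_ : ℝ → ℝ → Set
x < y = ∃[ ε ] (0ℚ ℚ.< ε × ∃[ N ] (∀ n → N ℕ.≤ n → seq x n ℚ.+ ε ℚ.≤ seq y n))

_≤_ : ℝ → ℝ → Set
x ≤ y = ∀ ε → 0ℚ ℚ.< ε → ∃[ N ] (∀ n → N ℕ.≤ n → seq x n ℚ.≤ seq y n ℚ.+ ε)

_≈_ : ℝ → ℝ → Set
x ≈ y = x ≤ y × y ≤ x

fromℚ : ℚ → ℝ
fromℚ q = mkℝ (λ _ → q) λ ε 0<ε →
  0 , λ _ _ _ _ → subst (λ r → ℚ.∣ r ∣ ℚ.< ε) (sym (ℚ.+-inverseʳ q)) 0<ε

fromℕ : ℕ → ℝ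
fromℕ n = fromℚ (+ n ℚ./ 1)

0ℝ : ℝ
0ℝ = fromℚ 0ℚ

private
  0<½ε : ∀ {ε} → 0ℚ ℚ.< ε → 0ℚ ℚ.< ½ ℚ.* ε
  0<½ε {ε} 0<ε = subst (ℚ._< ½ ℚ.* ε) (ℚ.*-zeroʳ ½) (ℚ.*-monoʳ-<-pos ½ 0<ε)

  ½ε+½ε≡ε : ∀ ε → ½ ℚ.* ε ℚ.+ ½ ℚ.* ε ≡ ε
  ½ε+½ε≡ε = solve 1 (λ e → con ½ :* e :+ con ½ :* e := e) refl
    where open +-*-Solver

  +-interchange-- : ∀ a b c d → (a ℚ.- c) ℚ.+ (b ℚ.- d) ≡ (a ℚ.+ b) ℚ.- (c ℚ.+ d)
  +-interchange-- = solve 4 (λ a b c d → (a :- c) :+ (b :- d) := (a :+ b) :- (c :+ d)) refl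
    where open +-*-Solver

  ∣p∣-∣q∣≤∣p-q∣ : ∀ p q → ℚ.∣ p ∣ ℚ.- ℚ.∣ q ∣ ℚ.≤ ℚ.∣ p ℚ.- q ∣
  ∣p∣-∣q∣≤∣p-q∣ p q = begin
    ℚ.∣ p ∣ ℚ.- ℚ.∣ q ∣                      ≡⟨ cong (λ r → ℚ.∣ r ∣ ℚ.- ℚ.∣ q ∣) (sym (p-q+q≡p p q)) ⟩
    ℚ.∣ (p ℚ.- q) ℚ.+ q ∣ ℚ.- ℚ.∣ q ∣        ≤⟨ ℚ.+-monoˡ-≤ (ℚ.- ℚ.∣ q ∣) (ℚ.∣p+q∣≤∣p∣+∣q∣ (p ℚ.- q) q) ⟩
    (ℚ.∣ p ℚ.- q ∣ ℚ.+ ℚ.∣ q ∣) ℚ.- ℚ.∣ q ∣  ≡⟨ p+q-q≡p ℚ.∣ p ℚ.- q ∣ ℚ.∣ q ∣ ⟩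
    ℚ.∣ p ℚ.- q ∣                            ∎
    where
    open ℚ.≤-Reasoning
    open +-*-Solver
    p-q+q≡p : ∀ p q → (p ℚ.- q) ℚ.+ q ≡ p
    p-q+q≡p = solve 2 (λ p q → (p :- q) :+ q := p) refl
    p+q-q≡p : ∀ p q → (p ℚ.+ q) ℚ.- q ≡ p
    p+q-q≡p = solve 2 (λ p q → (p :+ q) :- q := p) refl

  ∣p-q∣≡∣q-p∣ : ∀ p q → ℚ.∣ p ℚ.- q ∣ ≡ ℚ.∣ q ℚ.- p ∣
  ∣p-q∣≡∣q-p∣ p q = subst (λ r → ℚ.∣ r ∣ ≡ ℚ.∣ q ℚ.- p ∣) (neg p q) (ℚ.∣-p∣≡∣p∣ (q ℚ.- p))
    where
    open +-*-Solver
    neg : ∀ p q → ℚ.- (q ℚ.- p) ≡ p ℚ.- q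
    neg = solve 2 (λ p q → :- (q :- p) := p :- q) refl

  ∣∣p∣-∣q∣∣≤∣p-q∣ : ∀ p q → ℚ.∣ ℚ.∣ p ∣ ℚ.- ℚ.∣ q ∣ ∣ ℚ.≤ ℚ.∣ p ℚ.- q ∣
  ∣∣p∣-∣q∣∣≤∣p-q∣ p q with ℚ.∣p∣≡p∨∣p∣≡-p (ℚ.∣ p ∣ ℚ.- ℚ.∣ q ∣)
  ... | inj₁ eq = subst (ℚ._≤ ℚ.∣ p ℚ.- q ∣) (sym eq) (∣p∣-∣q∣≤∣p-q∣ p q)
  ... | inj₂ eq = subst₂ ℚ._≤_ (sym (trans eq (neg ℚ.∣ p ∣ ℚ.∣ q ∣))) (∣p-q∣≡∣q-p∣ q p)
                    (∣p∣-∣q∣≤∣p-q∣ q p)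
    where
    open +-*-Solver
    neg : ∀ p q → ℚ.- (p ℚ.- q) ≡ q ℚ.- p
    neg = solve 2 (λ p q → :- (p :- q) := q :- p) refl

infixl 6 _+_ _-_
infix  8 -_

_+_ : ℝ → ℝ → ℝ
seq    (x + y) n = seq x n ℚ.+ seq y n
cauchy (x + y) ε 0<ε = M ⊔ N , λ m n M⊔N≤m M⊔N≤n → begin-strict
  ℚ.∣ (seq x m ℚ.+ seq y m) ℚ.- (seq x n ℚ.+ seq y n) ∣
    ≡⟨ cong ℚ.∣_∣ (sym (+-interchange-- (seq x m) (seq y m) (seq x n) (seq y n))) ⟩
  ℚ.∣ (seq x m ℚ.- seq x n) ℚ.+ (seq y m ℚ.- seq y n) ∣
    ≤⟨ ℚ.∣p+q∣≤∣p∣+∣q∣ (seq x m ℚ.- seq x n) (seq y m ℚ.- seq y n) ⟩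
  ℚ.∣ seq x m ℚ.- seq x n ∣ ℚ.+ ℚ.∣ seq y m ℚ.- seq y n ∣
    <⟨ ℚ.+-mono-< (Mx m n (ℕ.m⊔n≤o⇒m≤o M N M⊔N≤m) (ℕ.m⊔n≤o⇒m≤o M N M⊔N≤n))
                  (Ny m n (ℕ.m⊔n≤o⇒n≤o M N M⊔N≤m) (ℕ.m⊔n≤o⇒n≤o M N M⊔N≤n)) ⟩
  ½ ℚ.* ε ℚ.+ ½ ℚ.* ε
    ≡⟨ ½ε+½ε≡ε ε ⟩
  ε ∎
  where
  open ℚ.≤-Reasoning
  M  = proj₁ (cauchy x (½ ℚ.* ε) (0<½ε 0<ε))
  Mx = proj₂ (cauchy x (½ ℚ.* ε) (0<½ε 0<ε))
  N  = proj₁ (cauchy y (½ ℚ.* ε) (0<½ε 0<ε))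
  Ny = proj₂ (cauchy y (½ ℚ.* ε) (0<½ε 0<ε))

-_ : ℝ → ℝ
seq    (- x) n = ℚ.- seq x n
cauchy (- x) ε 0<ε = N , λ m n N≤m N≤n →
  subst (ℚ._< ε) (∣q-p∣≡∣-p--q∣ (seq x m) (seq x n)) (Nx m n N≤m N≤n)
  where
  N  = proj₁ (cauchy x ε 0<ε)
  Nx = proj₂ (cauchy x ε 0<ε)
  open +-*-Solver
  ∣q-p∣≡∣-p--q∣ : ∀ p q → ℚ.∣ p ℚ.- q ∣ ≡ ℚ.∣ ℚ.- p ℚ.- ℚ.- q ∣
  ∣q-p∣≡∣-p--q∣ p q = subst (λ r → ℚ.∣ p ℚ.- q ∣ ≡ ℚ.∣ r ∣)
    (solve 2 (λ p q → q :- p := :- p :- (:- q)) refl p q) (∣p-q∣≡∣q-p∣ p q)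

_-_ : ℝ → ℝ → ℝ
x - y = x + (- y)

∣_∣ : ℝ → ℝ
seq    ∣ x ∣ n = ℚ.∣ seq x n ∣
cauchy ∣ x ∣ ε 0<ε = N , λ m n N≤m N≤n →
  ℚ.≤-<-trans (∣∣p∣-∣q∣∣≤∣p-q∣ (seq x m) (seq x n)) (Nx m n N≤m N≤n)
  where
  N  = proj₁ (cauchy x ε 0<ε)
  Nx = proj₂ (cauchy x ε 0<ε)

+-0-rawMonoid : RawMonoid 0ℓ 0ℓ
+-0-rawMonoid = record { Carrier = ℝ ; _≈_ = _≈_ ; _∙_ = _+_ ; ε = 0ℝ }

-- n · x is the n-fold sum x + ⋯ + x.
open RawMonoidDefinitions +-0-rawMonoid public using (sum) renaming (_×_ to infixr 8 _·_)

IsFloor : ℝ → ℕ → Set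
IsFloor y m = fromℕ m ≤ y × y < fromℕ (suc m)

infix 4 _⟶_

_⟶_ : (ℕ → ℝ) → ℝ → Set
s ⟶ l = ∀ ε → 0ℝ < ε → ∃[ N ] (∀ n → N ℕ.≤ n → ∣ s n - l ∣ < ε)

IsInf : (ℕ → ℝ) → ℝ → Set
IsInf s y = (∀ n → y ≤ s n) × (∀ z → (∀ n → z ≤ s n) → z ≤ y)

-- lim_{n→∞} inf_{m≥n} s m = l
IsLiminf : (ℕ → ℝ) → ℝ → Set
IsLiminf s l = Σ[ t ∈ (ℕ → ℝ) ] ((∀ n → IsInf (λ k → s (n ℕ.+ k)) (t n)) × t ⟶ l)

-- Σ_{i≥0} f i = l
IsSeriesSum : (ℕ → ℝ) → ℝ → Set
IsSeriesSum f l = (λ n → sum {n} (λ i → f (toℕ i))) ⟶ l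

module Words {b : ℕ} .{{_ : NonTrivial b}} {Ω : Set} (enum : Ω ↔ Fin b) where

  private instance
    b≢0 : NonZero b
    b≢0 = nonTrivial⇒nonZero b

  _/b^_ : ℕ → ℕ → ℚ
  n /b^ k = ℚ._/_ (+ n) (b ^ k) {{ℕ.m^n≢0 b k}}

  _≟_ : DecidableEquality Ω
  _≟_ = via-injection (↔⇒↣ enum) Fin._≟_

  _≟ʷ_ : DecidableEquality (List Ω)
  _≟ʷ_ = ≡-dec _≟_

  -- The number ∣v∣_w of occurrences of w in v.  The index j is the number of
  -- letters before the occurrence, so it starts at position j + 1.
  occurrences : List Ω → List Ω → ℕ
  occurrences w v =
    length (filter (λ j → take (length w) (drop j v) ≟ʷ w) (upTo (suc (length v) ∸ length w)))

  -- The elements of Ω^k, each listed once.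
  words : ∀ k → List (Vec Ω k)
  words zero    = [] List.∷ List.[]
  words (suc k) = cartesianProductWith _∷_ (List.map (Inverse.from enum) (allFin b)) (words k)

  -- A sequence x : ℕ → Ω has the letter x n at position n + 1, so
  -- applyUpTo x n is x[1…n].

  -- Z^λ_{i,k}(x), where M = ⌊λ b^k⌋.
  Z : (x : ℕ → Ω) (M i k : ℕ) → ℝ
  Z x M i k = fromℚ (length (filter occursTimes? (words k)) /b^ k)
    where
    occursTimes? = λ (w : Vec Ω k) →
      occurrences (Vec.toList w) (applyUpTo x (M ℕ.+ k ∸ 1)) ℕ.≟ i

  -- The limit over n ≥ 1 is indexed by n - 1.
  BorelNormal : (ℕ → Ω) → Set
  BorelNormal x = ∀ (w : List Ω) →
    (λ n → fromℚ (+ occurrences w (applyUpTo x (suc n)) ℚ./ suc n))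
      ⟶ fromℚ (1 /b^ length w)

{-# OPTIONS --safe #-}

-- Write M = ⌊λ b^k⌋ and c_w for the number of windows of length k, among the first M, equal to w.
-- Since Σ_w c_w = M ≤ λ b^k, the hypothesis Σ i p_i = λ leaves no mass at infinity: for every ε there is an m
-- such that, for all large k, the words with c_w ≥ m account for at most ε b^k windows.  Hence a function h ≥ 0 of
-- the window has Σ_{j≤M} h(window j) ≤ m Σ_w h(w) + ε b^k max h.
-- Apply this to h = |F_r|, where F_r adds up b^ℓ [block = u] - 1 over the first r disjoint blocks of length ℓ = |u|.
-- Over Ω^k these blocks are independent and centred, so Σ_w F_r(w)² ≤ r b^{2ℓ} b^k; as r grows, Σ_w |F_r(w)|
-- is small compared with r b^k.  On the other hand Σ_{j≤n} F_r(window j) is r (b^ℓ |x[1…n]|_u - n) up to an error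
-- depending only on r.  Every large n lies between ⌊λ b^{k-1}⌋ and ⌊λ b^k⌋ for some k, so b^k = O(n).
module Submission where

import Defs as ℝ
open import Data.Bool.Base using (if_then_else_; true; false)
open import Data.Fin.Base using (Fin; toℕ)
open import Data.Integer.Base as ℤ using (ℤ; +_; -[1+_]; 0ℤ; 1ℤ; +≤+)
import Data.Integer.Properties as ℤ
import Data.Integer.Solver as ℤSolver
open import Data.List.Base
  using (List; []; _∷_; map; filter; length; upTo; applyUpTo; allFin; take; drop; cartesianProductWith; _++_)
open import Data.List.Membership.Propositional using (_∈_)
open import Data.List.Membership.Propositional.Properties
  using (∈-upTo⁻; ∈-upTo⁺; ∈-map⁺; ∈-cartesianProductWith⁺; ∈-allFin)
open import Data.List.Properties
  using (map-upTo; length-upTo; length-map; length-++; length-applyUpTo; length-tabulate; take-all)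
open import Data.List.Relation.Unary.All as All using (All; []; _∷_)
open import Data.List.Relation.Unary.AllPairs using ([]; _∷_)
open import Data.List.Relation.Unary.Any using (here; there)
open import Data.List.Relation.Unary.Unique.Propositional using (Unique)
import Data.List.Relation.Unary.Unique.Propositional.Properties as Unique
open import Data.Nat.Base as ℕ
  using (ℕ; zero; suc; z≤n; s≤s; NonTrivial; NonZero; _∸_; _^_; _⊔_)
import Data.Nat.Properties as ℕ
open import Data.Product.Base using (_×_; _,_; ∃; proj₁; proj₂)
open import Data.Rational.Base as ℚ using (ℚ; mkℚ; 0ℚ; 1ℚ; ½; toℚᵘ; *<*; *≤*)
import Data.Rational.Properties as ℚ
import Data.Rational.Solver as ℚSolver
open import Data.Rational.Unnormalised.Base as ℚᵘ using (mkℚᵘ; *≡*)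
import Data.Rational.Unnormalised.Properties as ℚᵘ
open import Data.Sum.Base using (_⊎_; inj₁; inj₂)
open import Data.Vec.Base as Vec using (Vec; []; _∷_; toList; fromList)
import Data.Vec.Properties as Vec
open import Function.Base using (_∘_; id)
open import Function.Bundles using (_↔_; Inverse; module Injection)
open import Function.Properties.Inverse using (↔⇒↣; ↔-sym)
open import Relation.Binary.Definitions using (DecidableEquality)
open import Relation.Binary.PropositionalEquality
  using (_≡_; _≢_; refl; sym; trans; cong; cong₂; subst; subst₂; module ≡-Reasoning)
import Relation.Binary.Reasoning.Setoid as SetoidReasoning
open import Relation.Nullary.Decidable using (Dec; does; yes; no)
open import Relation.Nullary.Negation using (contradiction)
open import Relation.Unary using (Decidable)

-- Finite sums of integers over lists and initial segments.

module FiniteSums where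

  open import Data.Integer.Base using (_+_; _*_; _-_; -_; _≤_)
  open ℤSolver.+-*-Solver using (solve; con; _:=_; _:+_; _:*_; _:-_)

  private variable
    A B C : Set

  ‖_‖ : ℤ → ℤ
  ‖ i ‖ = + ℤ.∣ i ∣

  ‖‖-triangle : ∀ i j → ‖ i + j ‖ ≤ ‖ i ‖ + ‖ j ‖
  ‖‖-triangle i j = +≤+ (ℤ.∣i+j∣≤∣i∣+∣j∣ i j)

  0≤‖_‖ : ∀ i → 0ℤ ≤ ‖ i ‖
  0≤‖ i ‖ = +≤+ z≤n

  +-congˡ : ∀ i {j k} → j ≡ k → i + j ≡ i + k
  +-congˡ i = cong (λ j → i + j)

  ⟦_⟧ : {P : Set} → Dec P → ℤ
  ⟦ p? ⟧ = if does p? then 1ℤ else 0ℤ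

  ∑ : List A → (A → ℤ) → ℤ
  ∑ []       f = 0ℤ
  ∑ (x ∷ xs) f = f x + ∑ xs f

  ∑-cong : ∀ (xs : List A) {f g : A → ℤ} → (∀ {x} → x ∈ xs → f x ≡ g x) → ∑ xs f ≡ ∑ xs g
  ∑-cong []       f≗g = refl
  ∑-cong (x ∷ xs) f≗g = cong₂ _+_ (f≗g (here refl)) (∑-cong xs (f≗g ∘ there))

  ∑-mono : ∀ (xs : List A) {f g : A → ℤ} → (∀ {x} → x ∈ xs → f x ≤ g x) → ∑ xs f ≤ ∑ xs g
  ∑-mono []       f≤g = ℤ.≤-refl
  ∑-mono (x ∷ xs) f≤g = ℤ.+-mono-≤ (f≤g (here refl)) (∑-mono xs (f≤g ∘ there))

  ∑-+ : ∀ (xs : List A) (f g : A → ℤ) → ∑ xs (λ x → f x + g x) ≡ ∑ xs f + ∑ xs g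
  ∑-+ []       f g = refl
  ∑-+ (x ∷ xs) f g = trans (+-congˡ (f x + g x) (∑-+ xs f g))
    (solve 4 (λ a b c d → a :+ b :+ (c :+ d) := a :+ c :+ (b :+ d)) refl (f x) (g x) (∑ xs f) (∑ xs g))

  ∑-*ˡ : ∀ (xs : List A) c (f : A → ℤ) → ∑ xs (λ x → c * f x) ≡ c * ∑ xs f
  ∑-*ˡ []       c f = sym (ℤ.*-zeroʳ c)
  ∑-*ˡ (x ∷ xs) c f = trans (+-congˡ (c * f x) (∑-*ˡ xs c f)) (sym (ℤ.*-distribˡ-+ c (f x) (∑ xs f)))

  ∑-*ʳ : ∀ (xs : List A) c (f : A → ℤ) → ∑ xs (λ x → f x * c) ≡ ∑ xs f * c
  ∑-*ʳ xs c f = trans (∑-cong xs (λ {x} _ → ℤ.*-comm (f x) c)) (trans (∑-*ˡ xs c f) (ℤ.*-comm c (∑ xs f)))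

  ∑-const : ∀ (xs : List A) c → ∑ xs (λ _ → c) ≡ + length xs * c
  ∑-const []       c = refl
  ∑-const (x ∷ xs) c = trans (+-congˡ c (∑-const xs c))
    (solve 2 (λ c n → c :+ n :* c := (con 1ℤ :+ n) :* c) refl c (+ length xs))

  ∑-map : ∀ (g : A → B) xs (f : B → ℤ) → ∑ (map g xs) f ≡ ∑ xs (f ∘ g)
  ∑-map g []       f = refl
  ∑-map g (x ∷ xs) f = +-congˡ (f (g x)) (∑-map g xs f)

  ∑-++ : ∀ (xs ys : List A) (f : A → ℤ) → ∑ (xs ++ ys) f ≡ ∑ xs f + ∑ ys f
  ∑-++ []       ys f = sym (ℤ.+-identityˡ (∑ ys f))
  ∑-++ (x ∷ xs) ys f = trans (+-congˡ (f x) (∑-++ xs ys f)) (sym (ℤ.+-assoc (f x) (∑ xs f) (∑ ys f)))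

  ∑-cartesianProductWith : ∀ (g : A → B → C) xs ys (f : C → ℤ) →
    ∑ (cartesianProductWith g xs ys) f ≡ ∑ xs (λ x → ∑ ys (λ y → f (g x y)))
  ∑-cartesianProductWith g []       ys f = refl
  ∑-cartesianProductWith g (x ∷ xs) ys f = trans (∑-++ (map (g x) ys) (cartesianProductWith g xs ys) f)
    (cong₂ _+_ (∑-map (g x) ys f) (∑-cartesianProductWith g xs ys f))

  ∑-swap : ∀ (xs : List A) (ys : List B) (f : A → B → ℤ) →
    ∑ xs (λ x → ∑ ys (f x)) ≡ ∑ ys (λ y → ∑ xs (λ x → f x y))
  ∑-swap []       ys f = sym (trans (∑-const ys 0ℤ) (ℤ.*-zeroʳ (+ length ys)))
  ∑-swap (x ∷ xs) ys f = trans (+-congˡ (∑ ys (f x)) (∑-swap xs ys f))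
    (sym (∑-+ ys (f x) (λ y → ∑ xs (λ x → f x y))))

  ‖∑‖≤∑‖‖ : ∀ (xs : List A) (f : A → ℤ) → ‖ ∑ xs f ‖ ≤ ∑ xs (λ x → ‖ f x ‖)
  ‖∑‖≤∑‖‖ []       f = ℤ.≤-refl
  ‖∑‖≤∑‖‖ (x ∷ xs) f = ℤ.≤-trans (‖‖-triangle (f x) (∑ xs f)) (ℤ.+-monoʳ-≤ ‖ f x ‖ (‖∑‖≤∑‖‖ xs f))

  length-filter≡∑ : ∀ {P : A → Set} (P? : Decidable P) xs → + length (filter P? xs) ≡ ∑ xs (λ x → ⟦ P? x ⟧)
  length-filter≡∑ P? [] = refl
  length-filter≡∑ P? (x ∷ xs) with does (P? x)
  ... | true  = +-congˡ 1ℤ (length-filter≡∑ P? xs)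
  ... | false = trans (length-filter≡∑ P? xs) (sym (ℤ.+-identityˡ _))

  module _ (_≟_ : DecidableEquality A) where

    ⟦≟⟧-≢ : ∀ {x y} → x ≢ y → ⟦ x ≟ y ⟧ ≡ 0ℤ
    ⟦≟⟧-≢ {x} {y} x≢y with x ≟ y
    ... | yes x≡y = contradiction x≡y x≢y
    ... | no  _   = refl

    ⟦≟⟧-refl : ∀ x → ⟦ x ≟ x ⟧ ≡ 1ℤ
    ⟦≟⟧-refl x with x ≟ x
    ... | yes _   = refl
    ... | no  x≢x = contradiction refl x≢x

    ∑-select-∉ : ∀ {x} {xs : List A} (f : A → ℤ) → All (x ≢_) xs → ∑ xs (λ y → ⟦ x ≟ y ⟧ * f y) ≡ 0ℤ
    ∑-select-∉ f []           = refl
    ∑-select-∉ {xs = y ∷ _} f (x≢y ∷ x∉xs) =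
      cong₂ _+_ (cong (_* f y) (⟦≟⟧-≢ x≢y)) (∑-select-∉ f x∉xs)

    -- Without repetitions exactly one term survives. For the list of all words this turns a single
    -- value of a function into a sum over words, as double counting needs.
    ∑-select : ∀ {x} {xs : List A} (f : A → ℤ) → Unique xs → x ∈ xs → ∑ xs (λ y → ⟦ x ≟ y ⟧ * f y) ≡ f x
    ∑-select {x} f (x∉xs ∷ _) (here refl) =
      trans (cong₂ _+_ (trans (cong (_* f x) (⟦≟⟧-refl x)) (ℤ.*-identityˡ (f x))) (∑-select-∉ f x∉xs))
            (ℤ.+-identityʳ (f x))
    ∑-select {x} {y ∷ _} f (y∉xs ∷ uniq) (there x∈xs) =
      trans (cong₂ _+_ (cong (_* f y) (⟦≟⟧-≢ (x≢y y∉xs x∈xs))) (∑-select f uniq x∈xs)) (ℤ.+-identityˡ (f x))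
      where
      x≢y : ∀ {y xs} → All (y ≢_) xs → x ∈ xs → x ≢ y
      x≢y (y≢x ∷ _) (here refl) = y≢x ∘ sym
      x≢y (_ ∷ y∉)  (there x∈)  = x≢y y∉ x∈

  ∑-upTo-suc : ∀ n (f : ℕ → ℤ) → ∑ (upTo (suc n)) f ≡ f 0 + ∑ (upTo n) (f ∘ suc)
  ∑-upTo-suc n f = +-congˡ (f 0) (trans (cong (λ xs → ∑ xs f) (sym (map-upTo suc n))) (∑-map suc (upTo n) f))

  ∑-upTo-+ : ∀ m n (f : ℕ → ℤ) → ∑ (upTo (m ℕ.+ n)) f ≡ ∑ (upTo m) f + ∑ (upTo n) (f ∘ (m ℕ.+_))
  ∑-upTo-+ zero    n f = sym (ℤ.+-identityˡ _)
  ∑-upTo-+ (suc m) n f =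
    trans (∑-upTo-suc (m ℕ.+ n) f)
    (trans (+-congˡ (f 0) (∑-upTo-+ m n (f ∘ suc)))
    (trans (sym (ℤ.+-assoc (f 0) _ _))
           (cong (_+ ∑ (upTo n) (f ∘ (suc m ℕ.+_))) (sym (∑-upTo-suc m f)))))

  0≤∑ : ∀ (xs : List A) {f : A → ℤ} → (∀ {x} → x ∈ xs → 0ℤ ≤ f x) → 0ℤ ≤ ∑ xs f
  0≤∑ []       0≤f = ℤ.≤-refl
  0≤∑ (x ∷ xs) 0≤f = ℤ.+-mono-≤ (0≤f (here refl)) (0≤∑ xs (0≤f ∘ there))

  ∑-upTo-mono : ∀ {m n} {f : ℕ → ℤ} → (∀ j → 0ℤ ≤ f j) → m ℕ.≤ n → ∑ (upTo m) f ≤ ∑ (upTo n) f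
  ∑-upTo-mono {m} {n} {f} 0≤f m≤n = begin
    ∑ (upTo m) f                                          ≡⟨ ℤ.+-identityʳ _ ⟨
    ∑ (upTo m) f + 0ℤ
        ≤⟨ ℤ.+-monoʳ-≤ (∑ (upTo m) f) (0≤∑ (upTo (n ℕ.∸ m)) (λ {j} _ → 0≤f (m ℕ.+ j))) ⟩
    ∑ (upTo m) f + ∑ (upTo (n ℕ.∸ m)) (f ∘ (m ℕ.+_))      ≡⟨ ∑-upTo-+ m (n ℕ.∸ m) f ⟨
    ∑ (upTo (m ℕ.+ (n ℕ.∸ m))) f                          ≡⟨ cong (λ k → ∑ (upTo k) f) (ℕ.m+[n∸m]≡n m≤n) ⟩
    ∑ (upTo n) f                                          ∎
    where open ℤ.≤-Reasoning

  ‖∑-upTo‖≤ : ∀ n {f : ℕ → ℤ} {c} → (∀ j → ‖ f j ‖ ≤ c) → ‖ ∑ (upTo n) f ‖ ≤ + n * c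
  ‖∑-upTo‖≤ n {f} {c} ‖f‖≤c = begin
    ‖ ∑ (upTo n) f ‖              ≤⟨ ‖∑‖≤∑‖‖ (upTo n) f ⟩
    ∑ (upTo n) (λ j → ‖ f j ‖)    ≤⟨ ∑-mono (upTo n) (λ {j} _ → ‖f‖≤c j) ⟩
    ∑ (upTo n) (λ _ → c)          ≡⟨ ∑-const (upTo n) c ⟩
    + length (upTo n) * c         ≡⟨ cong (λ k → + k * c) (length-upTo n) ⟩
    + n * c                       ∎
    where open ℤ.≤-Reasoning

  -- The two ranges differ by `l` terms at each end. Splitting the sum over `n + l` indices in two
  -- ways avoids any comparison of `l` with `n`.
  ∑-upTo-shift : ∀ n l {f : ℕ → ℤ} {c} → (∀ j → ‖ f j ‖ ≤ c) →
    ‖ ∑ (upTo n) f - ∑ (upTo n) (f ∘ (l ℕ.+_)) ‖ ≤ + 2 * (+ l * c)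
  ∑-upTo-shift n l {f} {c} ‖f‖≤c = begin
    ‖ e - a ‖                     ≡⟨ cong ‖_‖ e-a≡d-g ⟩
    ‖ d - g ‖                     ≤⟨ ‖‖-triangle d (- g) ⟩
    ‖ d ‖ + ‖ - g ‖               ≡⟨ +-congˡ ‖ d ‖ (cong +_ (ℤ.∣-i∣≡∣i∣ g)) ⟩
    ‖ d ‖ + ‖ g ‖                 ≤⟨ ℤ.+-mono-≤ (‖∑-upTo‖≤ l ‖f‖≤c) (‖∑-upTo‖≤ l (λ j → ‖f‖≤c (n ℕ.+ j))) ⟩
    + l * c + + l * c             ≡⟨ solve 1 (λ i → i :+ i := con (+ 2) :* i) refl (+ l * c) ⟩
    + 2 * (+ l * c)               ∎
    where
    open ℤ.≤-Reasoning
    a = ∑ (upTo n) (f ∘ (l ℕ.+_))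
    d = ∑ (upTo l) f
    e = ∑ (upTo n) f
    g = ∑ (upTo l) (f ∘ (n ℕ.+_))
    e+g≡d+a : e + g ≡ d + a
    e+g≡d+a = trans (sym (∑-upTo-+ n l f)) (trans (cong (λ k → ∑ (upTo k) f) (ℕ.+-comm n l)) (∑-upTo-+ l n f))
    e-a≡d-g : e - a ≡ d - g
    e-a≡d-g = trans (solve 3 (λ e a g → e :- a := e :+ g :- (a :+ g)) refl e a g)
      (trans (cong (λ i → i - (a + g)) e+g≡d+a) (solve 3 (λ d a g → d :+ a :- (a :+ g) := d :- g) refl d a g))

-- Integer inequalities, windows of a sequence, truncated multiplicities.

module Counting where

  open import Data.Integer.Base using (_+_; _*_; _-_; -_; _≤_)
  open ℤSolver.+-*-Solver using (solve; con; _:=_; _:+_; _:*_; _:-_)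
  open FiniteSums
  open import Defs using (module Words)

  0≤i*i : ∀ i → 0ℤ ≤ i * i
  0≤i*i (+ n)    = subst (0ℤ ≤_) (ℤ.pos-* n n) (+≤+ z≤n)
  0≤i*i -[1+ n ] = +≤+ z≤n

  ‖i‖*‖i‖≡i*i : ∀ i → ‖ i ‖ * ‖ i ‖ ≡ i * i
  ‖i‖*‖i‖≡i*i (+ n)    = refl
  ‖i‖*‖i‖≡i*i -[1+ n ] = refl

  i≤‖i‖ : ∀ i → i ≤ ‖ i ‖
  i≤‖i‖ (+ n)    = ℤ.≤-refl
  i≤‖i‖ -[1+ n ] = ℤ.-≤+

  *-monoˡ-≤ : ∀ {i j k} → 0ℤ ≤ i → j ≤ k → i * j ≤ i * k
  *-monoˡ-≤ {i} 0≤i = ℤ.*-monoˡ-≤-nonNeg i {{ℤ.nonNegative 0≤i}}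

  *-monoʳ-≤ : ∀ {i j k} → 0ℤ ≤ i → j ≤ k → j * i ≤ k * i
  *-monoʳ-≤ {i} 0≤i = ℤ.*-monoʳ-≤-nonNeg i {{ℤ.nonNegative 0≤i}}

  2*i*j≤i*i+j*j : ∀ i j → + 2 * (i * j) ≤ i * i + j * j
  2*i*j≤i*i+j*j i j = ℤ.0≤i-j⇒j≤i (subst (0ℤ ≤_)
    (solve 2 (λ i j → (i :- j) :* (i :- j) := i :* i :+ j :* j :- con (+ 2) :* (i :* j)) refl i j)
    (0≤i*i (i - j)))

  module _ {A : Set} where

    -- Read off the infinite sequence, so its length is always `k`. `take` and `drop` on a finite
    -- prefix agree with it as long as the window fits.
    window : (ℕ → A) → ℕ → ℕ → List A
    window x zero    j = []
    window x (suc k) j = x j ∷ window x k (suc j)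

    length-window : ∀ x k j → length (window x k j) ≡ k
    length-window x zero    j = refl
    length-window x (suc k) j = cong suc (length-window x k (suc j))

    take-window : ∀ x l k j → take l (window x (l ℕ.+ k) j) ≡ window x l j
    take-window x zero    k j = refl
    take-window x (suc l) k j = cong (x j ∷_) (take-window x l k (suc j))

    drop-window : ∀ x l k j → drop l (window x (l ℕ.+ k) j) ≡ window x k (l ℕ.+ j)
    drop-window x zero    k j = refl
    drop-window x (suc l) k j = trans (drop-window x l k (suc j)) (cong (window x k) (ℕ.+-suc l j))

    window-∘suc : ∀ x k j → window (x ∘ suc) k j ≡ window x k (suc j)
    window-∘suc x zero    j = refl
    window-∘suc x (suc k) j = cong (x (suc j) ∷_) (window-∘suc x k (suc j))

    take-drop-applyUpTo : ∀ x k j n → j ℕ.+ k ℕ.≤ n → take k (drop j (applyUpTo x n)) ≡ window x k j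
    take-drop-applyUpTo x zero    zero    n       _         = refl
    take-drop-applyUpTo x (suc k) zero    (suc n) (s≤s k≤n) =
      cong (x 0 ∷_) (trans (take-drop-applyUpTo (x ∘ suc) k zero n k≤n) (window-∘suc x k 0))
    take-drop-applyUpTo x k       (suc j) (suc n) (s≤s j+k≤n) =
      trans (take-drop-applyUpTo (x ∘ suc) k j n j+k≤n) (window-∘suc x k j)

    take-++ : ∀ (v w : List A) → take (length v) (v ++ w) ≡ v
    take-++ []      w = refl
    take-++ (a ∷ v) w = cong (a ∷_) (take-++ v w)

    drop-++ : ∀ (v w : List A) → drop (length v) (v ++ w) ≡ w
    drop-++ []      w = refl
    drop-++ (a ∷ v) w = drop-++ v w

    length-cartesianProductWith : ∀ {B C : Set} (f : B → C → A) xs ys →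
      length (cartesianProductWith f xs ys) ≡ length xs ℕ.* length ys
    length-cartesianProductWith f []       ys = refl
    length-cartesianProductWith f (x ∷ xs) ys = trans (length-++ (map (f x) ys))
      (cong₂ ℕ._+_ (length-map (f x) ys) (length-cartesianProductWith f xs ys))

  -- This is `n` for `n < m` and 0 otherwise. As a sum of indicators it can be summed over words and
  -- the sums exchanged, which produces the partial sums of the series of `i` times the number of
  -- words occurring `i` times.
  truncatedTo : ℕ → ℕ → ℤ
  truncatedTo m n = ∑ (upTo m) (λ i → ⟦ n ℕ.≟ i ⟧ * + i)

  truncatedTo-cases : ∀ m n → (n ℕ.< m × truncatedTo m n ≡ + n) ⊎ (m ℕ.≤ n × truncatedTo m n ≡ 0ℤ)
  truncatedTo-cases m n with n ℕ.<? m
  ... | yes n<m = inj₁ (n<m , ∑-select ℕ._≟_ +_ (Unique.upTo⁺ m) (∈-upTo⁺ n<m))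
  ... | no  n≮m = inj₂ (ℕ.≮⇒≥ n≮m , ∑-select-∉ ℕ._≟_ +_
      (All.tabulate λ i∈ n≡i → n≮m (subst (ℕ._< m) (sym n≡i) (∈-upTo⁻ i∈))))

  m<n∸o⇒m+o<n : ∀ m o n → m ℕ.< n ∸ o → m ℕ.+ o ℕ.< n
  m<n∸o⇒m+o<n m o n m<n∸o = subst (m ℕ.+ o ℕ.<_)
      (ℕ.m∸n+n≡m (ℕ.<⇒≤ (ℕ.m∸n≢0⇒n<m {n} {o} λ eq → ℕ.n≮0 (subst (m ℕ.<_) eq m<n∸o)))) (ℕ.+-monoˡ-< o m<n∸o)

  -- For `n < m` the truncation is exact and `m * h` suffices; for `n ≥ m` the truncation is 0 and
  -- `n * H` suffices.
  weighted-≤-truncated : ∀ m n {h H} → 0ℤ ≤ h → h ≤ H → + n * h ≤ + m * h + (+ n - truncatedTo m n) * H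
  weighted-≤-truncated m n {h} {H} 0≤h h≤H with truncatedTo-cases m n
  ... | inj₁ (n<m , eq) rewrite eq = begin
    + n * h                        ≤⟨ *-monoʳ-≤ 0≤h (+≤+ (ℕ.<⇒≤ n<m)) ⟩
    + m * h                        ≡⟨ solve 3 (λ a n H → a := a :+ (n :- n) :* H) refl (+ m * h) (+ n) H ⟩
    + m * h + (+ n - + n) * H      ∎
    where open ℤ.≤-Reasoning
  ... | inj₂ (m≤n , eq) rewrite eq = begin
    + n * h                        ≤⟨ *-monoˡ-≤ {+ n} (+≤+ z≤n) h≤H ⟩
    + n * H                        ≡⟨ solve 2 (λ n H → n :* H := con 0ℤ :+ (n :- con 0ℤ) :* H) refl (+ n) H ⟩
    0ℤ + (+ n - 0ℤ) * H
        ≤⟨ ℤ.+-monoˡ-≤ ((+ n - 0ℤ) * H) (subst (_≤ + m * h) (ℤ.*-zeroʳ (+ m)) (*-monoˡ-≤ {+ m} (+≤+ z≤n) 0≤h)) ⟩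
    + m * h + (+ n - 0ℤ) * H       ∎
    where open ℤ.≤-Reasoning

  -- Sums over all words of a given length, and double counting of windows.

  module _ {b : ℕ} .{{_ : NonTrivial b}} {Ω : Set} (enum : Ω ↔ Fin b) where

    open Words enum

    letters : List Ω
    letters = map (Inverse.from enum) (allFin b)

    ∈-words : ∀ {k} (v : Vec Ω k) → v ∈ words k
    ∈-words []      = here refl
    ∈-words (a ∷ v) = ∈-cartesianProductWith⁺ _∷_
      (subst (_∈ letters) (Inverse.strictlyInverseʳ enum a)
          (∈-map⁺ (Inverse.from enum) (∈-allFin (Inverse.to enum a))))
      (∈-words v)

    words-unique : ∀ k → Unique (words k)
    words-unique zero    = [] ∷ []
    words-unique (suc k) = Unique.cartesianProductWith⁺ _∷_ Vec.∷-injective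
      (Unique.map⁺ (Injection.injective (↔⇒↣ (↔-sym enum))) (Unique.allFin⁺ b)) (words-unique k)

    length-words : ∀ k → length (words k) ≡ b ^ k
    length-words zero    = refl
    length-words (suc k) = trans (length-cartesianProductWith _∷_ letters (words k))
      (cong₂ ℕ._*_ (trans (length-map (Inverse.from enum) (allFin b)) (length-tabulate {n = b} id))
          (length-words k))

    -- The summand lives on lists rather than on `Vec Ω k`, so one function serves all lengths and
    -- concatenation needs no casts.
    ∑ʷ : ℕ → (List Ω → ℤ) → ℤ
    ∑ʷ k h = ∑ (words k) (h ∘ toList)

    ∑ʷ-cong : ∀ k {g h : List Ω → ℤ} → (∀ v → length v ≡ k → g v ≡ h v) → ∑ʷ k g ≡ ∑ʷ k h
    ∑ʷ-cong k g≗h = ∑-cong (words k) λ {v} _ → g≗h (toList v) (Vec.length-toList v)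

    ∑ʷ-mono : ∀ k {g h : List Ω → ℤ} → (∀ v → length v ≡ k → g v ≤ h v) → ∑ʷ k g ≤ ∑ʷ k h
    ∑ʷ-mono k g≤h = ∑-mono (words k) λ {v} _ → g≤h (toList v) (Vec.length-toList v)

    ∑ʷ-const : ∀ k c → ∑ʷ k (λ _ → c) ≡ + (b ^ k) * c
    ∑ʷ-const k c = trans (∑-const (words k) c) (cong (λ n → + n * c) (length-words k))

    -- Fubini for words of length `l + k` split into a head and a tail; this is the form in which
    -- the independence of disjoint blocks enters.
    ∑ʷ-++ : ∀ l k h → ∑ʷ (l ℕ.+ k) h ≡ ∑ʷ l (λ v → ∑ʷ k (λ w → h (v ++ w)))
    ∑ʷ-++ zero    k h = sym (ℤ.+-identityʳ (∑ʷ k h))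
    ∑ʷ-++ (suc l) k h = trans (∑-cartesianProductWith _∷_ letters (words (l ℕ.+ k)) (h ∘ toList))
      (trans (∑-cong letters λ {a} _ → ∑ʷ-++ l k (h ∘ (a ∷_)))
             (sym (∑-cartesianProductWith _∷_ letters (words l) (λ v → ∑ʷ k (λ w → h (toList v ++ w))))))

    ∑ʷ-select : ∀ v h → ∑ʷ (length v) (λ w → ⟦ v ≟ʷ w ⟧ * h w) ≡ h v
    ∑ʷ-select v h = trans (sym (∑-map toList (words (length v)) (λ w → ⟦ v ≟ʷ w ⟧ * h w)))
      (∑-select _≟ʷ_ h
        (Unique.map⁺ (λ {v} {w} eq → trans (sym (Vec.cast-is-id refl v)) (Vec.toList-injective refl v w eq))
                     (words-unique (length v)))
        (subst (_∈ map toList (words (length v))) (Vec.toList∘fromList v)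
            (∈-map⁺ toList (∈-words (fromList v)))))

    occurrences≡∑ : ∀ w x n → + occurrences w (applyUpTo x n) ≡
      ∑ (upTo (suc n ∸ length w)) (λ j → ⟦ window x (length w) j ≟ʷ w ⟧)
    occurrences≡∑ w x n
      rewrite length-filter≡∑ (λ j → take (length w) (drop j (applyUpTo x n)) ≟ʷ w)
                (upTo (suc (length (applyUpTo x n)) ∸ length w))
            | length-applyUpTo x n
      -- A start `j` below `suc n ∸ length w` leaves room for the whole window inside the prefix.
      = ∑-cong (upTo (suc n ∸ length w)) λ {j} j∈ →
          cong (λ v → ⟦ v ≟ʷ w ⟧)
            (take-drop-applyUpTo x (length w) j n (ℕ.s≤s⁻¹ (m<n∸o⇒m+o<n j (length w) (suc n) (∈-upTo⁻ j∈))))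

    multiplicity : (ℕ → Ω) → ℕ → ℕ → List Ω → ℕ
    multiplicity x M k w = occurrences w (applyUpTo x (M ℕ.+ k ∸ 1))

    -- For word length `suc k` the prefix has `M + k` letters, hence exactly `M` starting positions.
    -- For length 0 the truncated subtraction would spoil this at `M = 0`, so positive lengths are
    -- used throughout.
    multiplicity≡∑ : ∀ x M k w → length w ≡ suc k →
      + multiplicity x M (suc k) w ≡ ∑ (upTo M) (λ j → ⟦ window x (suc k) j ≟ʷ w ⟧)
    multiplicity≡∑ x M k w eq
      rewrite occurrences≡∑ w x (M ℕ.+ suc k ∸ 1) | eq | ℕ.+-suc M k | ℕ.m+n∸n≡m M k = refl

    -- Double counting: a word is charged once for every position at which it is the window.
    ∑ʷ-multiplicity : ∀ x M k h →
      ∑ʷ (suc k) (λ w → + multiplicity x M (suc k) w * h w) ≡ ∑ (upTo M) (λ j → h (window x (suc k) j))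
    ∑ʷ-multiplicity x M k h = begin
      ∑ʷ (suc k) (λ w → + multiplicity x M (suc k) w * h w)
        ≡⟨ ∑ʷ-cong (suc k) (λ w eq → trans (cong (_* h w) (multiplicity≡∑ x M k w eq))
                                             (sym (∑-*ʳ (upTo M) (h w) (λ j → ⟦ window x (suc k) j ≟ʷ w ⟧)))) ⟩
      ∑ʷ (suc k) (λ w → ∑ (upTo M) (λ j → ⟦ window x (suc k) j ≟ʷ w ⟧ * h w))
        ≡⟨ ∑-swap (words (suc k)) (upTo M) (λ w j → ⟦ window x (suc k) j ≟ʷ toList w ⟧ * h (toList w)) ⟩
      ∑ (upTo M) (λ j → ∑ʷ (suc k) (λ w → ⟦ window x (suc k) j ≟ʷ w ⟧ * h w))
        ≡⟨ ∑-cong (upTo M) (λ {j} _ → select j) ⟩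
      ∑ (upTo M) (λ j → h (window x (suc k) j)) ∎
      where
      open ≡-Reasoning
      select : ∀ j → ∑ʷ (suc k) (λ w → ⟦ window x (suc k) j ≟ʷ w ⟧ * h w) ≡ h (window x (suc k) j)
      select j = subst (λ l → ∑ʷ l (λ w → ⟦ window x (suc k) j ≟ʷ w ⟧ * h w) ≡ h (window x (suc k) j))
        (length-window x (suc k) j) (∑ʷ-select (window x (suc k) j) h)

    -- Z^λ_{i,k} = wordsOccurring x M k i / b^k.
    wordsOccurring : (ℕ → Ω) → ℕ → ℕ → ℕ → ℕ
    wordsOccurring x M k i = length (filter (λ w → multiplicity x M k (toList w) ℕ.≟ i) (words k))

    ∑ʷ-truncatedTo : ∀ x M k m →
      ∑ʷ k (λ w → truncatedTo m (multiplicity x M k w)) ≡ ∑ (upTo m) (λ i → + i * + wordsOccurring x M k i)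
    ∑ʷ-truncatedTo x M k m = trans
      (∑-swap (words k) (upTo m) (λ w i → ⟦ multiplicity x M k (toList w) ℕ.≟ i ⟧ * + i))
      (∑-cong (upTo m) λ {i} _ → trans
        (∑-*ʳ (words k) (+ i) (λ w → ⟦ multiplicity x M k (toList w) ℕ.≟ i ⟧))
        (trans (cong (_* + i) (sym (length-filter≡∑ (λ w → multiplicity x M k (toList w) ℕ.≟ i) (words k))))
               (ℤ.*-comm (+ wordsOccurring x M k i) (+ i))))

    -- The multiplicities add up to `M`, so the coefficient of `H` is the number of windows whose
    -- word occurs at least `m` times. Those windows are charged `H`; every other word is charged
    -- fewer than `m` times its own value.
    ∑-window-≤ : ∀ x M k m {h H} → (∀ w → 0ℤ ≤ h w) → (∀ w → h w ≤ H) →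
      ∑ (upTo M) (λ j → h (window x (suc k) j)) ≤
      + m * ∑ʷ (suc k) h + (+ M - ∑ (upTo m) (λ i → + i * + wordsOccurring x M (suc k) i)) * H
    ∑-window-≤ x M k m {h} {H} 0≤h h≤H = begin
      ∑ (upTo M) (λ j → h (window x (suc k) j))
        ≡⟨ ∑ʷ-multiplicity x M k h ⟨
      ∑ʷ (suc k) (λ w → + μ w * h w)
        ≤⟨ ∑ʷ-mono (suc k) (λ w _ → weighted-≤-truncated m (μ w) (0≤h w) (h≤H w)) ⟩
      ∑ʷ (suc k) (λ w → + m * h w + (+ μ w - τ w) * H)
        ≡⟨ ∑-+ (words (suc k)) (λ w → + m * h (toList w)) (λ w → (+ μ (toList w) - τ (toList w)) * H) ⟩
      ∑ʷ (suc k) (λ w → + m * h w) + ∑ʷ (suc k) (λ w → (+ μ w - τ w) * H)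
        ≡⟨ cong₂ _+_ (∑-*ˡ (words (suc k)) (+ m) (h ∘ toList))
            (∑-*ʳ (words (suc k)) H (λ w → + μ (toList w) - τ (toList w))) ⟩
      + m * ∑ʷ (suc k) h + ∑ʷ (suc k) (λ w → + μ w - τ w) * H
        ≡⟨ cong (λ s → + m * ∑ʷ (suc k) h + s * H) excess ⟩
      + m * ∑ʷ (suc k) h + (+ M - ∑ (upTo m) (λ i → + i * + wordsOccurring x M (suc k) i)) * H ∎
      where
      open ℤ.≤-Reasoning
      μ = multiplicity x M (suc k)
      τ = λ w → truncatedTo m (μ w)
      total : ∑ʷ (suc k) (λ w → + μ w) ≡ + M
      total = trans (∑ʷ-cong (suc k) λ w _ → sym (ℤ.*-identityʳ (+ μ w)))
        (trans (∑ʷ-multiplicity x M k (λ _ → 1ℤ))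
        (trans (∑-const (upTo M) 1ℤ) (trans (ℤ.*-identityʳ (+ length (upTo M))) (cong +_ (length-upTo M)))))
      excess : ∑ʷ (suc k) (λ w → + μ w - τ w) ≡ + M - ∑ (upTo m) (λ i → + i * + wordsOccurring x M (suc k) i)
      excess = trans (∑-+ (words (suc k)) (λ w → + μ (toList w)) (λ w → - τ (toList w)))
        (cong₂ _+_ total (trans (trans (∑ʷ-cong (suc k) (λ w _ → sym (ℤ.-1*i≡-i (τ w))))
                                       (trans (∑-*ˡ (words (suc k)) ℤ.-1ℤ (τ ∘ toList)) (ℤ.-1*i≡-i _)))
                                (cong -_ (∑ʷ-truncatedTo x M (suc k) m))))

  -- Centred block sums and their moments over all words.

  *-mono-≤ : ∀ {i j k l} → 0ℤ ≤ j → 0ℤ ≤ k → i ≤ j → k ≤ l → i * k ≤ j * l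
  *-mono-≤ 0≤j 0≤k i≤j k≤l = ℤ.≤-trans (*-monoʳ-≤ 0≤k i≤j) (*-monoˡ-≤ 0≤j k≤l)

  ⟦≟⟧-sym : ∀ {A : Set} (_≟_ : DecidableEquality A) x y → ⟦ x ≟ y ⟧ ≡ ⟦ y ≟ x ⟧
  ⟦≟⟧-sym _≟_ x y with x ≟ y | y ≟ x
  ... | yes _   | yes _   = refl
  ... | no  _   | no  _   = refl
  ... | yes x≡y | no  y≢x = contradiction (sym x≡y) y≢x
  ... | no  x≢y | yes y≡x = contradiction (sym y≡x) x≢y

  ‖n*⟦⟧-1‖≤n : ∀ {P : Set} n .{{_ : NonZero n}} (p? : Dec P) → ‖ + n * ⟦ p? ⟧ - 1ℤ ‖ ≤ + n
  ‖n*⟦⟧-1‖≤n (suc n) p? with does p?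
  ... | true  = subst (λ i → ‖ i - 1ℤ ‖ ≤ + suc n) (sym (ℤ.*-identityʳ (+ suc n))) (+≤+ (ℕ.n≤1+n n))
  ... | false = subst (λ i → ‖ i - 1ℤ ‖ ≤ + suc n) (sym (ℤ.*-zeroʳ (+ suc n))) (+≤+ (s≤s z≤n))

  module _ {b : ℕ} .{{_ : NonTrivial b}} {Ω : Set} (enum : Ω ↔ Fin b) (u : List Ω) where

    open Words enum

    private
      instance
        b≢0 : NonZero b
        b≢0 = ℕ.nonTrivial⇒nonZero b

      l = length u
      b^l = + (b ^ l)

    -- The indicator of the first block being `u`, scaled by `b^l` so that centring stays within the
    -- integers.
    deviation : List Ω → ℤ
    deviation v = b^l * ⟦ take l v ≟ʷ u ⟧ - 1ℤ

    blockSum : ℕ → List Ω → ℤ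
    blockSum zero    v = 0ℤ
    blockSum (suc r) v = deviation v + blockSum r (drop l v)

    ‖deviation‖≤ : ∀ v → ‖ deviation v ‖ ≤ b^l
    ‖deviation‖≤ v = ‖n*⟦⟧-1‖≤n (b ^ l) {{ℕ.m^n≢0 b l}} (take l v ≟ʷ u)

    private
      1+r*c≡ : ∀ r c → c + + r * c ≡ + suc r * c
      1+r*c≡ r c = sym (ℤ.suc-* (+ r) c)

    -- No condition on the length of `v` is imposed, so this serves directly as the uniform bound
    -- `H` in `∑-window-≤`.
    ‖blockSum‖≤ : ∀ r v → ‖ blockSum r v ‖ ≤ + r * b^l
    ‖blockSum‖≤ zero    v = +≤+ z≤n
    ‖blockSum‖≤ (suc r) v = subst (‖ blockSum (suc r) v ‖ ≤_) (1+r*c≡ r b^l)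
      (ℤ.≤-trans (‖‖-triangle (deviation v) (blockSum r (drop l v)))
                 (ℤ.+-mono-≤ (‖deviation‖≤ v) (‖blockSum‖≤ r (drop l v))))

    -- Exactly one of the `b^l` words equals `u`, so the scaled indicator contributes `b^l`, and so
    -- do the subtracted ones.
    ∑ʷ-deviation : ∑ʷ enum l deviation ≡ 0ℤ
    ∑ʷ-deviation = begin
      ∑ʷ enum l deviation
        ≡⟨ ∑ʷ-cong enum l (λ v eq → cong (λ i → b^l * i - 1ℤ) (trans
             (cong (λ w → ⟦ w ≟ʷ u ⟧) (take-all l v (ℕ.≤-reflexive eq)))
             (trans (⟦≟⟧-sym _≟ʷ_ v u) (sym (ℤ.*-identityʳ ⟦ u ≟ʷ v ⟧))))) ⟩
      ∑ʷ enum l (λ v → b^l * (⟦ u ≟ʷ v ⟧ * 1ℤ) - 1ℤ)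
        ≡⟨ ∑-+ (words l) _ (λ _ → - 1ℤ) ⟩
      ∑ʷ enum l (λ v → b^l * (⟦ u ≟ʷ v ⟧ * 1ℤ)) + ∑ʷ enum l (λ _ → - 1ℤ)
        ≡⟨ cong₂ _+_ (trans (∑-*ˡ (words l) b^l _) (cong (λ i → b^l * i) (∑ʷ-select enum u (λ _ → 1ℤ))))
            (∑ʷ-const enum l (- 1ℤ)) ⟩
      b^l * 1ℤ + b^l * - 1ℤ
        ≡⟨ solve 1 (λ b^l → b^l :* con 1ℤ :+ b^l :* con (- 1ℤ) := con 0ℤ) refl b^l ⟩
      0ℤ ∎
      where
      open ≡-Reasoning

    -- Distinct blocks are independent and each has mean 0, so the mixed terms of the square cancel.
    secondMoment : ∀ r s →
      ∑ʷ enum (r ℕ.* l ℕ.+ s) (λ v → blockSum r v * blockSum r v) ≤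
      + (b ^ (r ℕ.* l ℕ.+ s)) * (+ r * (b^l * b^l))
    secondMoment zero    s = ℤ.≤-reflexive (∑ʷ-const enum s 0ℤ)
    secondMoment (suc r) s rewrite ℕ.+-assoc l (r ℕ.* l) s = begin
      ∑ʷ enum (l ℕ.+ k) (λ v → blockSum (suc r) v * blockSum (suc r) v)
        ≡⟨ ∑ʷ-++ enum l k (λ v → blockSum (suc r) v * blockSum (suc r) v) ⟩
      ∑ʷ enum l (λ v → ∑ʷ enum k (λ w → blockSum (suc r) (v ++ w) * blockSum (suc r) (v ++ w)))
        ≡⟨ ∑ʷ-cong enum l expand ⟩
      ∑ʷ enum l (λ v → N * (deviation v * deviation v) + (+ 2 * S * deviation v + S²))
        ≡⟨ trans (∑-+ (words l) _ _) (cong₂ _+_ (∑-*ˡ (words l) N _)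
             (trans (∑-+ (words l) _ _) (cong₂ _+_ (trans (∑-*ˡ (words l) (+ 2 * S) _)
                 (cong (λ i → + 2 * S * i) ∑ʷ-deviation))
                                                   (∑ʷ-const enum l S²)))) ⟩
      N * ∑ʷ enum l (λ v → deviation v * deviation v) + (+ 2 * S * 0ℤ + b^l * S²)
        ≤⟨ ℤ.+-mono-≤ (*-monoˡ-≤ {N} (+≤+ z≤n) (ℤ.≤-trans (∑ʷ-mono enum l (λ v _ → deviation²≤ v))
            (ℤ.≤-reflexive (∑ʷ-const enum l (b^l * b^l)))))
                      (ℤ.+-monoʳ-≤ (+ 2 * S * 0ℤ) (*-monoˡ-≤ {b^l} (+≤+ z≤n) (secondMoment r s))) ⟩
      N * (b^l * (b^l * b^l)) + (+ 2 * S * 0ℤ + b^l * (N * (+ r * (b^l * b^l))))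
        ≡⟨ solve 4 (λ N b^l S r → N :* (b^l :* (b^l :* b^l)) :+
            (con (+ 2) :* S :* con 0ℤ :+ b^l :* (N :* (r :* (b^l :* b^l))))
                     := b^l :* N :* ((con 1ℤ :+ r) :* (b^l :* b^l))) refl N b^l S (+ r) ⟩
      b^l * N * (+ suc r * (b^l * b^l))
        ≡⟨ cong (λ i → i * (+ suc r * (b^l * b^l)))
            (trans (sym (ℤ.pos-* (b ^ l) (b ^ k))) (cong +_ (sym (ℕ.^-distribˡ-+-* b l k)))) ⟩
      + (b ^ (l ℕ.+ k)) * (+ suc r * (b^l * b^l)) ∎
      where
      open ℤ.≤-Reasoning
      k = r ℕ.* l ℕ.+ s
      N = + (b ^ k)
      S = ∑ʷ enum k (blockSum r)
      S² = ∑ʷ enum k (λ w → blockSum r w * blockSum r w)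
      deviation²≤ : ∀ v → deviation v * deviation v ≤ b^l * b^l
      deviation²≤ v = subst (_≤ b^l * b^l) (‖i‖*‖i‖≡i*i (deviation v))
        (*-mono-≤ (+≤+ z≤n) (+≤+ z≤n) (‖deviation‖≤ v) (‖deviation‖≤ v))
      blockSum-++ : ∀ v w → length v ≡ l → blockSum (suc r) (v ++ w) ≡ deviation v + blockSum r w
      blockSum-++ v w eq rewrite sym eq | take-++ v w | drop-++ v w | take-all (length v) v ℕ.≤-refl = refl
      expand : ∀ v → length v ≡ l →
        ∑ʷ enum k (λ w → blockSum (suc r) (v ++ w) * blockSum (suc r) (v ++ w)) ≡
        N * (deviation v * deviation v) + (+ 2 * S * deviation v + S²)
      expand v eq = trans
        (∑ʷ-cong enum k λ w _ → trans (cong (λ i → i * i) (blockSum-++ v w eq))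
          (solve 2 (λ d s → (d :+ s) :* (d :+ s) := d :* d :+ (con (+ 2) :* d :* s :+ s :* s)) refl
              (deviation v) (blockSum r w)))
        (trans (∑-+ (words k) _ _) (cong₂ _+_ (∑ʷ-const enum k (deviation v * deviation v))
          (trans (∑-+ (words k) _ _) (cong (λ i → i + S²)
            (trans (∑-*ˡ (words k) (+ 2 * deviation v) _)
                   (solve 2 (λ d S → con (+ 2) :* d :* S := con (+ 2) :* S :* d) refl (deviation v) S))))))

    -- Sum 2 t |F| ≤ F² + t² over all words: with t² blocks both terms on the right are of order t².
    firstMoment : ∀ t s .{{_ : NonZero t}} → let k = t ℕ.* t ℕ.* l ℕ.+ s in
      ∑ʷ enum k (λ v → ‖ blockSum (t ℕ.* t) v ‖) ≤ + t * (b^l * b^l + 1ℤ) * + (b ^ k)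
    -- Cancelling `t` bounds `2 * A`; the factor 2 is then given away, since `A` is nonnegative.
    firstMoment t@(suc _) s = ℤ.≤-trans A≤2A (ℤ.*-cancelˡ-≤-pos (+ 2 * A) _ (+ t) (begin
      + t * (+ 2 * A)
        ≡⟨ trans (solve 2 (λ t A → t :* (con (+ 2) :* A) := con (+ 2) :* t :* A) refl (+ t) A)
            (sym (∑-*ˡ (words k) (+ 2 * + t) _)) ⟩
      ∑ʷ enum k (λ v → + 2 * + t * ‖ F v ‖)
        ≤⟨ ∑ʷ-mono enum k (λ v _ → subst₂ _≤_ (sym (ℤ.*-assoc (+ 2) (+ t) ‖ F v ‖))
              (trans (cong (λ i → + t * + t + i) (‖i‖*‖i‖≡i*i (F v))) (ℤ.+-comm (+ t * + t) (F v * F v)))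
              (2*i*j≤i*i+j*j (+ t) ‖ F v ‖)) ⟩
      ∑ʷ enum k (λ v → F v * F v + + t * + t)
        ≡⟨ trans (∑-+ (words k) _ (λ _ → + t * + t))
            (+-congˡ (∑ʷ enum k (λ v → F v * F v)) (∑ʷ-const enum k (+ t * + t))) ⟩
      ∑ʷ enum k (λ v → F v * F v) + N * (+ t * + t)
        ≤⟨ ℤ.+-monoˡ-≤ (N * (+ t * + t)) (secondMoment (t ℕ.* t) s) ⟩
      N * (+ (t ℕ.* t) * (b^l * b^l)) + N * (+ t * + t)
        ≡⟨ cong (λ i → N * (i * (b^l * b^l)) + N * (+ t * + t)) (ℤ.pos-* t t) ⟩
      N * (+ t * + t * (b^l * b^l)) + N * (+ t * + t)
        ≡⟨ solve 3 (λ N t b^l → N :* (t :* t :* (b^l :* b^l)) :+ N :* (t :* t) := t :*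
            (t :* (b^l :* b^l :+ con 1ℤ) :* N)) refl N (+ t) b^l ⟩
      + t * (+ t * (b^l * b^l + 1ℤ) * N) ∎))
      where
      open ℤ.≤-Reasoning
      k = t ℕ.* t ℕ.* l ℕ.+ s
      N = + (b ^ k)
      F = blockSum (t ℕ.* t)
      A = ∑ʷ enum k (λ v → ‖ F v ‖)
      A≤2A : A ≤ + 2 * A
      A≤2A = subst₂ _≤_ (ℤ.*-identityˡ A) refl
          (*-monoʳ-≤ (0≤∑ (words k) (λ _ → +≤+ z≤n)) (+≤+ {1} {2} (s≤s z≤n)))

    -- Block sums along the sequence and the discrepancy of a prefix.

    module _ (x : ℕ → Ω) where

      deviationAt : ℕ → ℤ
      deviationAt j = b^l * ⟦ window x l j ≟ʷ u ⟧ - 1ℤ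

      blockSumAt : ℕ → ℕ → ℤ
      blockSumAt zero    j = 0ℤ
      blockSumAt (suc r) j = deviationAt j + blockSumAt r (l ℕ.+ j)

      -- The `s` letters after the last block do not enter. Removing the window length from the
      -- block sum lets the later error constant be chosen before `k`.
      blockSum-window : ∀ r s j → blockSum r (window x (r ℕ.* l ℕ.+ s) j) ≡ blockSumAt r j
      blockSum-window zero    s j = refl
      blockSum-window (suc r) s j rewrite ℕ.+-assoc l (r ℕ.* l) s =
        cong₂ _+_ (cong (λ v → b^l * ⟦ v ≟ʷ u ⟧ - 1ℤ) (take-window x l (r ℕ.* l ℕ.+ s) j))
          (trans (cong (blockSum r) (drop-window x l (r ℕ.* l ℕ.+ s) j)) (blockSum-window r s (l ℕ.+ j)))

      ‖blockSumAt‖≤ : ∀ r j → ‖ blockSumAt r j ‖ ≤ + r * b^l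
      ‖blockSumAt‖≤ r j = subst (λ i → ‖ i ‖ ≤ + r * b^l) (blockSum-window r 0 j)
          (‖blockSum‖≤ r (window x (r ℕ.* l ℕ.+ 0) j))

      -- This is `b^l` times the number of occurrences of `u` starting at the first `n` positions,
      -- minus `n`.
      discrepancy : ℕ → ℤ
      discrepancy n = ∑ (upTo n) deviationAt

      -- Splitting off the first block leaves the sum for `r` blocks shifted by `l` positions.
      -- Undoing the shift costs only boundary terms, whose size does not involve `n`.
      discrepancy-∑blockSumAt : ∀ r → ∃ λ C → ∀ n → ‖ + r * discrepancy n - ∑ (upTo n) (blockSumAt r) ‖ ≤ C
      discrepancy-∑blockSumAt zero = 0ℤ , λ n → ℤ.≤-reflexive (cong (λ i → ‖ 0ℤ * discrepancy n - i ‖)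
        (trans (∑-const (upTo n) 0ℤ) (ℤ.*-zeroʳ (+ length (upTo n)))))
      discrepancy-∑blockSumAt (suc r) = C + + 2 * (+ l * (+ r * b^l)) , λ n → let
          G = discrepancy n
          S = ∑ (upTo n) (blockSumAt r)
          S′ = ∑ (upTo n) (λ j → blockSumAt r (l ℕ.+ j))
        in begin
          ‖ + suc r * G - ∑ (upTo n) (blockSumAt (suc r)) ‖
            ≡⟨ cong (λ i → ‖ + suc r * G - i ‖) (∑-+ (upTo n) deviationAt (λ j → blockSumAt r (l ℕ.+ j))) ⟩
          ‖ + suc r * G - (G + S′) ‖
            ≡⟨ cong ‖_‖ (solve 4 (λ r G S S′ → (con 1ℤ :+ r) :* G :- (G :+ S′) := r :* G :- S :+ (S :- S′))
                refl (+ r) G S S′) ⟩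
          ‖ + r * G - S + (S - S′) ‖
            ≤⟨ ‖‖-triangle (+ r * G - S) (S - S′) ⟩
          ‖ + r * G - S ‖ + ‖ S - S′ ‖
            ≤⟨ ℤ.+-mono-≤ (bound n) (∑-upTo-shift n l (‖blockSumAt‖≤ r)) ⟩
          C + + 2 * (+ l * (+ r * b^l)) ∎
        where
        open ℤ.≤-Reasoning
        C = proj₁ (discrepancy-∑blockSumAt r)
        bound = proj₂ (discrepancy-∑blockSumAt r)

      -- With `t * t` blocks the scaled discrepancy is a sum of block sums up to `C`. Passing to
      -- absolute values allows the range to grow from `n` to `M` positions, where `∑-window-≤` and
      -- then `firstMoment` apply. `C` is fixed before `M`, `k`, `m` and `n`.
      discrepancy-≤ : ∀ t .{{_ : NonZero t}} → ∃ λ C → ∀ M k m n → n ℕ.≤ M → t ℕ.* t ℕ.* l ℕ.≤ suc k →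
        + (t ℕ.* t) * ‖ discrepancy n ‖ ≤
        + m * (+ t * (b^l * b^l + 1ℤ) * + (b ^ suc k)) +
        (+ M - ∑ (upTo m) (λ i → + i * + wordsOccurring enum x M (suc k) i)) * (+ (t ℕ.* t) * b^l) + C
      discrepancy-≤ t = C , λ M k m n n≤M r*l≤k → let
          r = t ℕ.* t
          S = ∑ (upTo n) (blockSumAt r)
          i = + r * discrepancy n
          s = suc k ∸ r ℕ.* l
          k≡ = ℕ.m+[n∸m]≡n r*l≤k
          T = + M - ∑ (upTo m) (λ i → + i * + wordsOccurring enum x M (suc k) i)
        in begin
          + r * ‖ discrepancy n ‖
            ≡⟨ trans (sym (ℤ.pos-* r _)) (cong +_ (sym (ℤ.∣i*j∣≡∣i∣*∣j∣ (+ r) (discrepancy n)))) ⟩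
          ‖ i ‖
            ≡⟨ cong ‖_‖ (solve 2 (λ i S → i := S :+ (i :- S)) refl i S) ⟩
          ‖ S + (i - S) ‖
            ≤⟨ ‖‖-triangle S (i - S) ⟩
          ‖ S ‖ + ‖ i - S ‖
            ≤⟨ ℤ.+-mono-≤ (‖∑‖≤∑‖‖ (upTo n) (blockSumAt r)) (bound n) ⟩
          ∑ (upTo n) (λ j → ‖ blockSumAt r j ‖) + C
            ≤⟨ ℤ.+-monoˡ-≤ C (∑-upTo-mono (λ j → 0≤‖ blockSumAt r j ‖) n≤M) ⟩
          ∑ (upTo M) (λ j → ‖ blockSumAt r j ‖) + C
            ≡⟨ cong (λ i → i + C) (∑-cong (upTo M) λ {j} _ → cong ‖_‖ (sym
                 (subst (λ k → blockSum r (window x k j) ≡ blockSumAt r j) k≡ (blockSum-window r s j)))) ⟩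
          ∑ (upTo M) (λ j → ‖ blockSum r (window x (suc k) j) ‖) + C
            ≤⟨ ℤ.+-monoˡ-≤ C (∑-window-≤ enum x M k m (λ w → 0≤‖ blockSum r w ‖) (‖blockSum‖≤ r)) ⟩
          + m * ∑ʷ enum (suc k) (λ w → ‖ blockSum r w ‖) + T * (+ r * b^l) + C
            ≤⟨ ℤ.+-monoˡ-≤ C (ℤ.+-monoˡ-≤ (T * (+ r * b^l)) (*-monoˡ-≤ {+ m} (+≤+ z≤n)
                 (subst (λ k → ∑ʷ enum k (λ w → ‖ blockSum r w ‖) ≤ + t * (b^l * b^l + 1ℤ) * + (b ^ k)) k≡
                     (firstMoment t s)))) ⟩
          + m * (+ t * (b^l * b^l + 1ℤ) * + (b ^ suc k)) + T * (+ r * b^l) + C ∎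
        where
        open ℤ.≤-Reasoning
        C = proj₁ (discrepancy-∑blockSumAt (t ℕ.* t))
        bound = proj₂ (discrepancy-∑blockSumAt (t ℕ.* t))

  -- Growth of scales, and the balance of the three error terms.

  k<b^k : ∀ b .{{_ : NonTrivial b}} k → k ℕ.< b ^ k
  k<b^k b zero    = s≤s z≤n
  k<b^k b (suc k) = begin-strict
    suc k                ≡⟨ ℕ.+-comm 1 k ⟩
    k ℕ.+ 1              <⟨ ℕ.+-mono-<-≤ (k<b^k b k) (ℕ.≤-<-trans z≤n (k<b^k b k)) ⟩
    b ^ k ℕ.+ b ^ k      ≡⟨ cong (b ^ k ℕ.+_) (ℕ.+-identityʳ (b ^ k)) ⟨
    2 ℕ.* b ^ k          ≤⟨ ℕ.*-monoˡ-≤ (b ^ k) (ℕ.nonTrivial⇒n>1 b) ⟩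
    b ℕ.* b ^ k          ∎
    where open ℕ.≤-Reasoning

  -- A discrete intermediate value argument: descend from `K + d` until the value first drops below
  -- `n`. Monotonicity of `f` is not assumed.
  crossing : ∀ (f : ℕ → ℕ) K n d → f K ℕ.< n → n ℕ.≤ f (K ℕ.+ d) →
    ∃ λ k → K ℕ.≤ k × f k ℕ.< n × n ℕ.≤ f (suc k)
  crossing f K n zero    fK<n n≤f = contradiction (subst (λ k → n ℕ.≤ f k) (ℕ.+-identityʳ K) n≤f) (ℕ.<⇒≱ fK<n)
  crossing f K n (suc d) fK<n n≤f with n ℕ.≤? f (K ℕ.+ d)
  ... | yes n≤f′ = crossing f K n d fK<n n≤f′
  ... | no  n≰f′ = K ℕ.+ d , ℕ.m≤m+n K d , ℕ.≰⇒> n≰f′ , subst (λ k → n ℕ.≤ f k) (ℕ.+-suc K d) n≤f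

  -- The three terms of the hypothesis on g contribute at most t²n each to 3et²g.
  combine : ∀ e m d t p n {C N X g} .{{_ : NonZero d}} .{{_ : NonZero t}} →
    let A = + p * + p + 1ℤ in
    + (t ℕ.* t) * g ≤ + m * (+ t * A * N) + X * (+ (t ℕ.* t) * + p) + C →
    + 3 * + e * + p * + d * X ≤ N → N ≤ + d * + n → + 3 * + e * C ≤ + n →
    + 3 * + e * + m * A * + d ≤ + t →
    + e * g ≤ + n
  combine e m d@(suc _) t@(suc t-1) p n {C} {N} {X} {g} t²g≤ X≤N N≤dn C≤n ≤t =
    ℤ.*-cancelˡ-≤-pos (+ e * g) (+ n) (+ (3 ℕ.* (t ℕ.* t))) (begin
      + (3 ℕ.* (t ℕ.* t)) * (+ e * g)
        ≡⟨ trans (cong (λ i → i * (+ e * g)) (ℤ.pos-* 3 (t ℕ.* t)))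
             (solve 3 (λ T e g → con (+ 3) :* T :* (e :* g) := con (+ 3) :* e :* (T :* g)) refl T (+ e) g) ⟩
      + 3 * + e * (T * g)
        ≤⟨ *-monoˡ-≤ 0≤3e t²g≤ ⟩
      + 3 * + e * (+ m * (+ t * A * N) + X * (T * + p) + C)
        ≡⟨ solve 9 (λ e m t A N X T p C → con (+ 3) :* e :* (m :* (t :* A :* N) :+ X :* (T :* p) :+ C)
              := t :* (con (+ 3) :* e :* m :* A :* N) :+ T :* (con (+ 3) :* e :* p :* X) :+ con (+ 3) :* e :* C)
              refl (+ e) (+ m) (+ t) A N X T (+ p) C ⟩
      + t * (+ 3 * + e * + m * A * N) + T * (+ 3 * + e * + p * X) + + 3 * + e * C
        ≤⟨ ℤ.+-mono-≤ (ℤ.+-mono-≤ (*-monoˡ-≤ {+ t} (+≤+ z≤n) N-term) (*-monoˡ-≤ {T} (+≤+ z≤n) X-term))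
            (ℤ.≤-trans C≤n n≤Tn) ⟩
      + t * (+ t * + n) + T * + n + T * + n
        ≡⟨ trans (cong (λ i → i + T * + n + T * + n)
            (trans (sym (ℤ.*-assoc (+ t) (+ t) (+ n))) (cong (λ i → i * + n) (sym (ℤ.pos-* t t)))))
             (solve 2 (λ T n → T :* n :+ T :* n :+ T :* n := con (+ 3) :* T :* n) refl T (+ n)) ⟩
      + 3 * T * + n
        ≡⟨ cong (λ i → i * + n) (ℤ.pos-* 3 (t ℕ.* t)) ⟨
      + (3 ℕ.* (t ℕ.* t)) * + n ∎)
    where
    open ℤ.≤-Reasoning
    T = + (t ℕ.* t)
    A = + p * + p + 1ℤ
    0≤3e : 0ℤ ≤ + 3 * + e
    0≤3e = *-mono-≤ {0ℤ} {+ 3} {0ℤ} {+ e} (+≤+ z≤n) ℤ.≤-refl (+≤+ z≤n) (+≤+ z≤n)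
    0≤A : 0ℤ ≤ A
    0≤A = ℤ.+-mono-≤ (0≤i*i (+ p)) (+≤+ {0} {1} z≤n)
    0≤3emA : 0ℤ ≤ + 3 * + e * + m * A
    0≤3emA = *-mono-≤ {0ℤ} {_} {0ℤ} {A} (*-mono-≤ {0ℤ} {_} {0ℤ} {+ m} 0≤3e ℤ.≤-refl 0≤3e (+≤+ z≤n)) ℤ.≤-refl
      (*-mono-≤ {0ℤ} {_} {0ℤ} {+ m} 0≤3e ℤ.≤-refl 0≤3e (+≤+ z≤n)) 0≤A
    N-term : + 3 * + e * + m * A * N ≤ + t * + n
    N-term = ℤ.≤-trans (*-monoˡ-≤ 0≤3emA N≤dn)
      (subst (_≤ + t * + n) (ℤ.*-assoc (+ 3 * + e * + m * A) (+ d) (+ n)) (*-monoʳ-≤ (+≤+ z≤n) ≤t))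
    X-term : + 3 * + e * + p * X ≤ + n
    X-term = ℤ.*-cancelˡ-≤-pos _ _ (+ d) (ℤ.≤-trans (subst (_≤ N)
      (solve 4 (λ e p d X → con (+ 3) :* e :* p :* d :* X := d :* (con (+ 3) :* e :* p :* X)) refl (+ e) (+ p)
          (+ d) X) X≤N) N≤dn)
    n≤Tn : + n ≤ T * + n
    n≤Tn = subst (_≤ T * + n) (ℤ.*-identityˡ (+ n)) (*-monoʳ-≤ {+ n} {1ℤ} {T} (+≤+ z≤n) (+≤+ (s≤s z≤n)))

  -- From the scales `b ^ k` to every large prefix length.

  module _ {b : ℕ} .{{_ : NonTrivial b}} {Ω : Set} (enum : Ω ↔ Fin b) (x : ℕ → Ω) (M : ℕ → ℕ)
    (Q : ℕ) (b^k≤Q*M : ∀ k → b ^ k ℕ.≤ suc Q ℕ.* suc (M k))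
    (tightness : ∀ E → ∃ λ m → ∃ λ K → ∀ k → K ℕ.≤ k →
      + E * (+ M (suc k) - ∑ (upTo m) (λ i → + i * + wordsOccurring enum x (M (suc k)) (suc k) i)) ≤
      + (b ^ suc k))
    (u : List Ω) where

    open Words enum

    private
      instance
        b≢0 : NonZero b
        b≢0 = ℕ.nonTrivial⇒nonZero b

      l = length u
      p = b ^ l
      d = b ℕ.* suc Q

      instance
        d≢0 : NonZero d
        d≢0 = ℕ.m*n≢0 b (suc Q)

    -- Otherwise `b ^ k ≤ suc Q * n ≤ k`, against `k < b ^ k`. This supplies the upper end for
    -- `crossing`.
    n≤M : ∀ n k → suc Q ℕ.* n ℕ.≤ k → n ℕ.≤ M k
    n≤M n k Qn≤k with n ℕ.≤? M k
    ... | yes n≤Mk = n≤Mk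
    ... | no  n≰Mk = contradiction (k<b^k b k)
      (ℕ.≤⇒≯ (ℕ.≤-trans (b^k≤Q*M k) (ℕ.≤-trans (ℕ.*-monoʳ-≤ (suc Q) (ℕ.≰⇒> n≰Mk)) Qn≤k)))

    -- The constants are chosen in the order `E`, then `m` and `K` by tightness, then `t` from `m`,
    -- then `C` from `t`, and the threshold last.
    discrepancy-sublinear : ∀ e → ∃ λ N → ∀ n → N ℕ.≤ n → + e * ‖ discrepancy enum u x n ‖ ≤ + n
    -- The first summand puts `n` above `M K₀`, where `crossing` starts; the second absorbs the
    -- constant `C`.
    discrepancy-sublinear e = suc (M K₀) ℕ.+ ℤ.∣ + 3 * + e * C ∣ , λ n N≤n → let
        k , K₀≤k , Mk<n , n≤Mk = crossing M K₀ n (suc Q ℕ.* n) (ℕ.m+n≤o⇒m≤o (suc (M K₀)) N≤n)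
            (n≤M n _ (ℕ.m≤n+m _ K₀))
      in combine e m d t p n {C} {+ (b ^ suc k)} {X k}
        (bound (M (suc k)) k m n n≤Mk (ℕ.≤-trans (ℕ.m≤n+m _ K) (ℕ.≤-trans K₀≤k (ℕ.n≤1+n k))))
        (subst (λ i → i * X k ≤ + (b ^ suc k)) E≡ (small k (ℕ.m+n≤o⇒m≤o K K₀≤k)))
        -- At the crossing scale `M k < n`, so the bound on `b ^ k` gives `b ^ suc k ≤ d * n`; the
        -- extra factor `b` in `d` pays for the step from `k` to `suc k`.
        (subst (+ (b ^ suc k) ≤_) (ℤ.pos-* d n) (+≤+ (begin
          b ℕ.* b ^ k                 ≤⟨ ℕ.*-monoʳ-≤ b (b^k≤Q*M k) ⟩
          b ℕ.* (suc Q ℕ.* suc (M k)) ≡⟨ ℕ.*-assoc b (suc Q) (suc (M k)) ⟨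
          d ℕ.* suc (M k)             ≤⟨ ℕ.*-monoʳ-≤ d Mk<n ⟩
          d ℕ.* n                     ∎)))
        (ℤ.≤-trans (i≤‖i‖ _) (+≤+ (ℕ.m+n≤o⇒n≤o (suc (M K₀)) N≤n)))
        (subst (_≤ + t) t-1≡ (+≤+ (ℕ.n≤1+n t-1)))
      where
      open ℕ.≤-Reasoning
      -- The factor that `combine` requires on the excess `X`: its term then takes up at most a
      -- third of the allowance.
      E = 3 ℕ.* e ℕ.* p ℕ.* d
      m = proj₁ (tightness E)
      K = proj₁ (proj₂ (tightness E))
      small = proj₂ (proj₂ (tightness E))
      X = λ k → + M (suc k) - ∑ (upTo m) (λ i → + i * + wordsOccurring enum x (M (suc k)) (suc k) i)
      -- The first moment term grows like `t` against `t * t` on the left, so `t` has to outweigh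
      -- its coefficient.
      t-1 = 3 ℕ.* e ℕ.* m ℕ.* (p ℕ.* p ℕ.+ 1) ℕ.* d
      t = suc t-1
      C = proj₁ (discrepancy-≤ enum u x t)
      bound = proj₂ (discrepancy-≤ enum u x t)
      -- From `K₀` on tightness applies and a window has room for `t * t` blocks of length `l`.
      K₀ = K ℕ.+ t ℕ.* t ℕ.* l
      pos-*₄ : ∀ i j k l → + (i ℕ.* j ℕ.* k ℕ.* l) ≡ + i * + j * + k * + l
      pos-*₄ i j k l = trans (ℤ.pos-* (i ℕ.* j ℕ.* k) l) (cong (λ n → n * + l)
        (trans (ℤ.pos-* (i ℕ.* j) k) (cong (λ n → n * + k) (ℤ.pos-* i j))))
      E≡ : + E ≡ + 3 * + e * + p * + d
      E≡ = pos-*₄ 3 e p d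
      t-1≡ : + t-1 ≡ + 3 * + e * + m * (+ p * + p + 1ℤ) * + d
      t-1≡ = trans (ℤ.pos-* (3 ℕ.* e ℕ.* m ℕ.* (p ℕ.* p ℕ.+ 1)) d) (cong (λ n → n * + d)
        (trans (pos-*₄ 3 e m (p ℕ.* p ℕ.+ 1)) (cong (λ n → + 3 * + e * + m * (n + 1ℤ)) (ℤ.pos-* p p))))

    -- Here `n′` counts the starting positions in a prefix of `n` letters, which is the range of
    -- summation in `occurrences≡∑`.
    occurrences-discrepancy : ∀ n → let n′ = suc n ∸ l in
      + p * + occurrences u (applyUpTo x n) ≡ discrepancy enum u x n′ + + n′
    occurrences-discrepancy n = sym (trans (cong (λ i → i + + n′)
        (trans (∑-+ (upTo n′) _ (λ _ → - 1ℤ)) (cong₂ _+_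
          (trans (∑-*ˡ (upTo n′) (+ p) _) (cong (λ i → + p * i) (sym (occurrences≡∑ enum u x n))))
          (trans (∑-const (upTo n′) (- 1ℤ)) (cong (λ i → + i * - 1ℤ) (length-upTo n′))))))
      (solve 2 (λ a n → a :+ n :* con (- 1ℤ) :+ n := a) refl (+ p * + occurrences u (applyUpTo x n)) (+ n′)))
      where n′ = suc n ∸ l

    occurrences-equidistributed : ∀ E → ∃ λ N → ∀ n → N ℕ.≤ n →
      + E * ‖ + p * + occurrences u (applyUpTo x n) - + n ‖ ≤ + n
    -- `N + l` makes `n′` at least `N` and its subtraction exact. The rest absorbs the difference of
    -- at most `suc l` between `n′` and `n`; as `e = 2 * E`, discrepancy and boundary together may
    -- reach `2 * n`.
    occurrences-equidistributed E = N ℕ.+ l ℕ.+ (1 ℕ.+ e ℕ.* suc l) , λ n N≤n → let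
        n′ = suc n ∸ l
        G = discrepancy enum u x n′
        N+l≤n = ℕ.m+n≤o⇒m≤o (N ℕ.+ l) N≤n
        N≤n′ = ℕ.m+n≤o⇒m≤o∸n N (ℕ.≤-trans N+l≤n (ℕ.n≤1+n n))
        n′+l≡1+n = ℕ.m∸n+n≡m (ℕ.≤-trans (ℕ.m+n≤o⇒n≤o N N+l≤n) (ℕ.n≤1+n n))
        n′≡ : + n′ ≡ + n + (1ℤ - + l)
        n′≡ = trans (solve 2 (λ n l → n := n :+ l :- l) refl (+ n′) (+ l))
            (trans (cong (λ k → + k - + l) n′+l≡1+n)
          (solve 2 (λ n l → con 1ℤ :+ n :- l := n :+ (con 1ℤ :- l)) refl (+ n) (+ l)))
      in ℤ.*-cancelˡ-≤-pos (+ E * ‖ + p * + occurrences u (applyUpTo x n) - + n ‖) (+ n) (+ 2) (begin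
        + 2 * (+ E * ‖ + p * + occurrences u (applyUpTo x n) - + n ‖)
          ≡⟨ trans (sym (ℤ.*-assoc (+ 2) (+ E) _)) (cong₂ _*_ (sym (ℤ.pos-* 2 E)) (cong ‖_‖ (trans
               (cong (λ i → i - + n) (trans (occurrences-discrepancy n) (cong (λ i → G + i) n′≡)))
               (solve 3 (λ G n i → G :+ (n :+ i) :- n := G :+ i) refl G (+ n) (1ℤ - + l))))) ⟩
        + e * ‖ G + (1ℤ - + l) ‖
          ≤⟨ *-monoˡ-≤ {+ e} (+≤+ z≤n) (ℤ.≤-trans (‖‖-triangle G (1ℤ - + l))
              (ℤ.+-monoʳ-≤ ‖ G ‖ (+≤+ (ℤ.∣i-j∣≤∣i∣+∣j∣ 1ℤ (+ l))))) ⟩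
        + e * (‖ G ‖ + + suc l)
          ≡⟨ trans (ℤ.*-distribˡ-+ (+ e) ‖ G ‖ (+ suc l))
              (cong (λ i → + e * ‖ G ‖ + i) (sym (ℤ.pos-* e (suc l)))) ⟩
        + e * ‖ G ‖ + + (e ℕ.* suc l)
          ≤⟨ ℤ.+-monoˡ-≤ (+ (e ℕ.* suc l)) (bound n′ N≤n′) ⟩
        + (n′ ℕ.+ e ℕ.* suc l)
          ≤⟨ +≤+ (ℕ.+-monoˡ-≤ (e ℕ.* suc l) (ℕ.m∸n≤m (suc n) l)) ⟩
        + (suc n ℕ.+ e ℕ.* suc l)
          ≡⟨ cong +_ (sym (ℕ.+-suc n (e ℕ.* suc l))) ⟩
        + (n ℕ.+ suc (e ℕ.* suc l))
          ≤⟨ +≤+ (ℕ.+-monoʳ-≤ n (ℕ.m+n≤o⇒n≤o (N ℕ.+ l) N≤n)) ⟩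
        + (n ℕ.+ n)
          ≡⟨ trans (cong (λ k → + (n ℕ.+ k)) (sym (ℕ.+-identityʳ n))) (ℤ.pos-* 2 n) ⟩
        + 2 * + n ∎)
      where
      open ℤ.≤-Reasoning
      e = 2 ℕ.* E
      N = proj₁ (discrepancy-sublinear e)
      bound = proj₂ (discrepancy-sublinear e)

-- Integers inside the rationals, and clearing of denominators.

module Limits where

  open FiniteSums using (‖_‖; ∑; ∑-upTo-suc)
  open Counting using (wordsOccurring)
  open import Data.Rational.Base using (_/_; _+_; _*_; _-_; -_; _≤_; _<_; ∣_∣; ↧_)
  open import Data.Rational.Unnormalised.Base using (_≃_)
  open ℚSolver.+-*-Solver using (solve; con; _:=_; _:+_; _:*_; _:-_; :-_)
  open import Defs using (ℝ; seq; fromℚ; fromℕ; 0ℝ; IsFloor; _·_; sum; IsLiminf; IsSeriesSum; module Words)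

  ι : ℤ → ℚ
  ι z = z / 1

  toℚᵘ-ι : ∀ z → toℚᵘ (ι z) ≃ mkℚᵘ z 0
  toℚᵘ-ι z = ℚ.toℚᵘ-fromℚᵘ (mkℚᵘ z 0)

  ι-+ : ∀ y z → ι (y ℤ.+ z) ≡ ι y + ι z
  ι-+ y z = ℚ.toℚᵘ-injective (begin
    toℚᵘ (ι (y ℤ.+ z))             ≈⟨ toℚᵘ-ι (y ℤ.+ z) ⟩
    mkℚᵘ (y ℤ.+ z) 0
        ≈⟨ *≡* (cong (ℤ._* 1ℤ) (cong₂ ℤ._+_ (sym (ℤ.*-identityʳ y)) (sym (ℤ.*-identityʳ z)))) ⟩
    mkℚᵘ y 0 ℚᵘ.+ mkℚᵘ z 0         ≈⟨ ℚᵘ.+-cong (toℚᵘ-ι y) (toℚᵘ-ι z) ⟨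
    toℚᵘ (ι y) ℚᵘ.+ toℚᵘ (ι z)     ≈⟨ ℚ.toℚᵘ-homo-+ (ι y) (ι z) ⟨
    toℚᵘ (ι y + ι z)               ∎)
    where open SetoidReasoning ℚᵘ.≃-setoid

  ι-* : ∀ y z → ι (y ℤ.* z) ≡ ι y * ι z
  ι-* y z = ℚ.toℚᵘ-injective (begin
    toℚᵘ (ι (y ℤ.* z))             ≈⟨ toℚᵘ-ι (y ℤ.* z) ⟩
    mkℚᵘ y 0 ℚᵘ.* mkℚᵘ z 0         ≈⟨ ℚᵘ.*-cong (toℚᵘ-ι y) (toℚᵘ-ι z) ⟨
    toℚᵘ (ι y) ℚᵘ.* toℚᵘ (ι z)     ≈⟨ ℚ.toℚᵘ-homo-* (ι y) (ι z) ⟨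
    toℚᵘ (ι y * ι z)               ∎)
    where open SetoidReasoning ℚᵘ.≃-setoid

  z/n*n≡z : ∀ z n .{{_ : NonZero n}} → z / n * ι (+ n) ≡ ι z
  z/n*n≡z z n@(suc n-1) = ℚ.toℚᵘ-injective (begin
    toℚᵘ (z / n * ι (+ n))             ≈⟨ ℚ.toℚᵘ-homo-* (z / n) (ι (+ n)) ⟩
    toℚᵘ (z / n) ℚᵘ.* toℚᵘ (ι (+ n))   ≈⟨ ℚᵘ.*-cong (ℚ.toℚᵘ-fromℚᵘ (mkℚᵘ z n-1)) (toℚᵘ-ι (+ n)) ⟩
    mkℚᵘ z n-1 ℚᵘ.* mkℚᵘ (+ n) 0       ≈⟨ *≡* (ℤ.*-assoc z (+ n) 1ℤ) ⟩
    mkℚᵘ z 0                           ≈⟨ toℚᵘ-ι z ⟨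
    toℚᵘ (ι z)                         ∎)
    where open SetoidReasoning ℚᵘ.≃-setoid

  ι-mono-≤ : ∀ {y z} → y ℤ.≤ z → ι y ≤ ι z
  ι-mono-≤ {y} {z} y≤z = ℚ.toℚᵘ-cancel-≤ (begin
    toℚᵘ (ι y)   ≃⟨ toℚᵘ-ι y ⟩
    mkℚᵘ y 0     ≤⟨ ℚᵘ.*≤* (ℤ.*-monoʳ-≤-nonNeg 1ℤ y≤z) ⟩
    mkℚᵘ z 0     ≃⟨ toℚᵘ-ι z ⟨
    toℚᵘ (ι z)   ∎)
    where open ℚᵘ.≤-Reasoning

  ι-cancel-≤ : ∀ {y z} → ι y ≤ ι z → y ℤ.≤ z
  ι-cancel-≤ {y} {z} ιy≤ιz = ℤ.*-cancelʳ-≤-pos y z 1ℤ (ℚᵘ.drop-*≤* (begin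
    mkℚᵘ y 0     ≃⟨ toℚᵘ-ι y ⟨
    toℚᵘ (ι y)   ≤⟨ ℚ.toℚᵘ-mono-≤ ιy≤ιz ⟩
    toℚᵘ (ι z)   ≃⟨ toℚᵘ-ι z ⟩
    mkℚᵘ z 0     ∎))
    where open ℚᵘ.≤-Reasoning

  ι-- : ∀ y z → ι (y ℤ.- z) ≡ ι y - ι z
  ι-- y z = trans (solve 2 (λ a c → a := a :+ c :- c) refl (ι (y ℤ.- z)) (ι z))
    (cong (_- ι z) (trans (sym (ι-+ (y ℤ.- z) z)) (cong ι
        (ℤ+.solve 2 (λ y z → y ℤ+.:- z ℤ+.:+ z ℤ+.:= y) refl y z))))
    where module ℤ+ = ℤSolver.+-*-Solver

  ∣ι∣ : ∀ z → ∣ ι z ∣ ≡ ι ‖ z ‖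
  ∣ι∣ (+ n)    = ℚ.0≤p⇒∣p∣≡p (ι-mono-≤ {0ℤ} {+ n} (ℤ.+≤+ z≤n))
  ∣ι∣ -[1+ n ] = trans (ℚ.∣-p∣≡∣p∣ (ι (+ suc n))) (ℚ.0≤p⇒∣p∣≡p (ι-mono-≤ {0ℤ} {+ suc n} (ℤ.+≤+ z≤n)))

  0<ι : ∀ n .{{_ : NonZero n}} → 0ℚ < ι (+ n)
  0<ι (suc n) = ℚ.<-≤-trans (*<* (ℤ.+<+ (s≤s z≤n))) (ι-mono-≤ {1ℤ} {+ suc n} (ℤ.+≤+ (s≤s z≤n)))

  0≤ι : ∀ n → 0ℚ ≤ ι (+ n)
  0≤ι n = ι-mono-≤ {0ℤ} {+ n} (ℤ.+≤+ z≤n)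

  *-monoˡ : ∀ {p q r} → 0ℚ ≤ p → q ≤ r → p * q ≤ p * r
  *-monoˡ {p} 0≤p = ℚ.*-monoˡ-≤-nonNeg p {{ℚ.nonNegative 0≤p}}

  *-monoʳ : ∀ {p q r} → 0ℚ ≤ p → q ≤ r → q * p ≤ r * p
  *-monoʳ {p} 0≤p = ℚ.*-monoʳ-≤-nonNeg p {{ℚ.nonNegative 0≤p}}

  *-pos : ∀ {p q} → 0ℚ < p → 0ℚ < q → 0ℚ < p * q
  *-pos {p} {q} 0<p 0<q = subst (_< p * q) (ℚ.*-zeroʳ p) (ℚ.*-monoʳ-<-pos p {{ℚ.positive 0<p}} 0<q)

  p≤∣p∣ : ∀ p → p ≤ ∣ p ∣
  p≤∣p∣ p with ℚ.≤-total 0ℚ p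
  ... | inj₁ 0≤p = ℚ.≤-reflexive (sym (ℚ.0≤p⇒∣p∣≡p 0≤p))
  ... | inj₂ p≤0 = ℚ.≤-trans p≤0 (ℚ.0≤∣p∣ p)

  recip : ℕ → ℚ
  recip n = 1ℤ / suc n

  recip-* : ∀ n → recip n * ι (+ suc n) ≡ 1ℚ
  recip-* n = z/n*n≡z 1ℤ (suc n)

  0<recip : ∀ n → 0ℚ < recip n
  0<recip n = ℚ.positive⁻¹ (recip n) {{ℚ.normalize-pos 1 (suc n)}}

  -- The denominator of `ε` is the multiplier: the product is the numerator, a positive integer.
  archimedean : ∀ {ε} → 0ℚ < ε → ∃ λ n → 1ℚ ≤ ι (+ suc n) * ε
  archimedean {ε@(mkℚ p d-1 _)} (*<* 0<p) = d-1 , (begin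
    1ℚ                     ≤⟨ ι-mono-≤ (ℤ.i<j⇒suc[i]≤j (subst (0ℤ ℤ.<_) (ℤ.*-identityʳ p) 0<p)) ⟩
    ι p                    ≡⟨ z/n*n≡z p (suc d-1) ⟨
    p / suc d-1 * ι (↧ ε)  ≡⟨ cong (_* ι (↧ ε)) (ℚ.↥p/↧p≡p ε) ⟩
    ε * ι (↧ ε)            ≡⟨ ℚ.*-comm ε (ι (↧ ε)) ⟩
    ι (↧ ε) * ε            ∎)
    where open ℚ.≤-Reasoning

  -- Eventual inequalities between rational approximations, and lower limits.

  Eventually : (ℕ → Set) → Set
  Eventually P = ∃ λ J → ∀ j → J ℕ.≤ j → P j

  eventually-map₂ : ∀ {P Q R : ℕ → Set} → (∀ j → P j → Q j → R j) → Eventually P → Eventually Q → Eventually R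
  eventually-map₂ f (J , p) (K , q) = J ⊔ K , λ j J⊔K≤j →
    f j (p j (ℕ.m⊔n≤o⇒m≤o J K J⊔K≤j)) (q j (ℕ.m⊔n≤o⇒n≤o J K J⊔K≤j))

  eventually-map : ∀ {P Q : ℕ → Set} → (∀ j → P j → Q j) → Eventually P → Eventually Q
  eventually-map f (J , p) = J , λ j J≤j → f j (p j J≤j)

  eventually-∃ : ∀ {P : ℕ → Set} → Eventually P → ∃ P
  eventually-∃ (J , p) = J , p J ℕ.≤-refl

  fromℚ-pos : ∀ {ε} → 0ℚ < ε → 0ℝ ℝ.< fromℚ ε
  fromℚ-pos {ε} 0<ε = ε , 0<ε , 0 , λ _ _ → ℚ.≤-reflexive (ℚ.+-identityˡ ε)

  <⇒eventually-≤ : ∀ y z → y ℝ.< z → Eventually (λ j → seq y j ≤ seq z j)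
  <⇒eventually-≤ y z (ε , 0<ε , N , y+ε≤z) = N , λ j N≤j →
    ℚ.≤-trans (ℚ.≤-trans (ℚ.≤-reflexive (sym (ℚ.+-identityʳ (seq y j)))) (ℚ.+-monoʳ-≤ (seq y j) (ℚ.<⇒≤ 0<ε)))
        (y+ε≤z j N≤j)

  ∣p-q∣≤r⇒p≤q+r : ∀ p q {r} → ∣ p - q ∣ ≤ r → p ≤ q + r
  ∣p-q∣≤r⇒p≤q+r p q {r} ≤r = subst (_≤ q + r) (solve 2 (λ p q → q :+ (p :- q) := p) refl p q)
    (ℚ.+-monoʳ-≤ q (ℚ.≤-trans (p≤∣p∣ (p - q)) ≤r))

  ∣p-q∣≤r⇒q≤p+r : ∀ p q {r} → ∣ p - q ∣ ≤ r → q ≤ p + r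
  ∣p-q∣≤r⇒q≤p+r p q {r} ≤r = ∣p-q∣≤r⇒p≤q+r q p
    (subst (_≤ r) (trans (sym (ℚ.∣-p∣≡∣p∣ (p - q)))
        (cong ∣_∣ (solve 2 (λ p q → :- (p :- q) := q :- p) refl p q))) ≤r)

  ½*p+½*p≡p : ∀ p → ½ * p + ½ * p ≡ p
  ½*p+½*p≡p = solve 1 (λ p → con ½ :* p :+ con ½ :* p := p) refl

  0<½* : ∀ {p} → 0ℚ < p → 0ℚ < ½ * p
  0<½* = *-pos {½} (*<* (ℤ.+<+ (s≤s z≤n)))

  seq-· : ∀ n x j → seq (n · x) j ≡ ι (+ n) * seq x j
  seq-· zero    x j = sym (ℚ.*-zeroˡ (seq x j))
  seq-· (suc n) x j = trans (cong (λ q → seq x j + q) (seq-· n x j))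
    (trans (solve 2 (λ n x → x :+ n :* x := (con 1ℚ :+ n) :* x) refl (ι (+ n)) (seq x j))
           (cong (_* seq x j) (sym (ι-+ 1ℤ (+ n)))))

  ∑ℚ : ℕ → (ℕ → ℚ) → ℚ
  ∑ℚ zero    q = 0ℚ
  ∑ℚ (suc m) q = q 0 + ∑ℚ m (q ∘ suc)

  ∑ℚ-ι : ∀ m {q : ℕ → ℚ} {f : ℕ → ℤ} c → (∀ i → q i * c ≡ ι (f i)) → ∑ℚ m q * c ≡ ι (∑ (upTo m) f)
  ∑ℚ-ι zero    c eq = ℚ.*-zeroˡ c
  ∑ℚ-ι (suc m) {q} {f} c eq = trans (ℚ.*-distribʳ-+ c (q 0) (∑ℚ m (q ∘ suc)))
    (trans (cong₂ _+_ (eq 0) (∑ℚ-ι m c (eq ∘ suc)))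
    (trans (sym (ι-+ (f 0) (∑ (upTo m) (f ∘ suc)))) (cong ι (sym (∑-upTo-suc m f)))))

  -- The rational form of `y ≤ liminf q`. The inner `Eventually` runs over the Cauchy approximations
  -- of `y`, and its threshold may depend on `k`.
  UltimatelyBelow : ℝ → (ℕ → ℚ) → Set
  UltimatelyBelow y q = ∀ ε → 0ℚ < ε →
    Eventually (λ k → Eventually (λ j → seq y j ≤ q k + ε))

  -- Some tail infimum `t N` is within half of `ε` of `y` and lies below every `q k` with `k ≥ N`;
  -- the other half pays for comparing reals through approximations.
  liminf-below : ∀ {q : ℕ → ℚ} {y} → IsLiminf (fromℚ ∘ q) y → UltimatelyBelow y q
  liminf-below {q} {y} (t , t-inf , t⟶y) ε 0<ε with t⟶y (fromℚ (½ * ε)) (fromℚ-pos (0<½* 0<ε))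
  ... | N , near = N , λ k N≤k → eventually-map₂
    (λ j near≤ t≤ → begin
      seq y j                       ≤⟨ ∣p-q∣≤r⇒q≤p+r (seq (t N) j) (seq y j) near≤ ⟩
      seq (t N) j + ½ * ε           ≤⟨ ℚ.+-monoˡ-≤ (½ * ε) t≤ ⟩
      q (N ℕ.+ (k ℕ.∸ N)) + ½ * ε + ½ * ε
        ≡⟨ trans (ℚ.+-assoc (q (N ℕ.+ (k ℕ.∸ N))) (½ * ε) (½ * ε))
            (cong₂ _+_ (cong q (ℕ.m+[n∸m]≡n N≤k)) (½*p+½*p≡p ε)) ⟩
      q k + ε ∎)
    (<⇒eventually-≤ ℝ.∣ t N ℝ.- y ∣ (fromℚ (½ * ε)) (near N ℕ.≤-refl))
    (proj₁ (t-inf N) (k ℕ.∸ N) (½ * ε) (0<½* 0<ε))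
    where open ℚ.≤-Reasoning

  ·-below : ∀ n {y q} → UltimatelyBelow y q → UltimatelyBelow (n · y) (λ k → ι (+ n) * q k)
  ·-below n {y} {q} y≤q ε 0<ε = eventually-map
    (λ k → eventually-map λ j y≤ → begin
      seq (n · y) j                              ≡⟨ seq-· n y j ⟩
      ι (+ n) * seq y j                          ≤⟨ *-monoˡ (0≤ι n) y≤ ⟩
      ι (+ n) * (q k + recip n * ε)              ≡⟨ ℚ.*-distribˡ-+ (ι (+ n)) (q k) (recip n * ε) ⟩
      ι (+ n) * q k + ι (+ n) * (recip n * ε)
          ≤⟨ ℚ.+-monoʳ-≤ (ι (+ n) * q k) (*-monoʳ (ℚ.<⇒≤ 0<δ) (ι-mono-≤ (ℤ.+≤+ (ℕ.n≤1+n n)))) ⟩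
      ι (+ n) * q k + ι (+ suc n) * (recip n * ε)
        ≡⟨ cong (λ r → ι (+ n) * q k + r) (trans (solve 3 (λ n r e → n :* (r :* e) := r :* n :* e) refl
            (ι (+ suc n)) (recip n) ε)
             (trans (cong (_* ε) (recip-* n)) (ℚ.*-identityˡ ε))) ⟩
      ι (+ n) * q k + ε ∎)
    -- The precision is `ε` divided by `suc n` rather than by `n`, which also covers `n = 0`.
    (y≤q (recip n * ε) 0<δ)
    where
    open ℚ.≤-Reasoning
    0<δ = *-pos (0<recip n) 0<ε

  -- Superadditivity of the lower limit for finite sums: half of the remaining error goes to each
  -- next term.
  sum-below : ∀ {f : ℕ → ℝ} {q : ℕ → ℕ → ℚ} → (∀ i → UltimatelyBelow (f i) (q i)) →
    ∀ m → UltimatelyBelow (sum {m} (λ i → f (toℕ i))) (λ k → ∑ℚ m (λ i → q i k))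
  sum-below f≤q zero    ε 0<ε = 0 , λ _ _ → 0 , λ _ _ → ℚ.≤-trans (ℚ.<⇒≤ 0<ε)
      (ℚ.≤-reflexive (sym (ℚ.+-identityˡ ε)))
  sum-below {f} {q} f≤q (suc m) ε 0<ε = eventually-map₂
    (λ k → eventually-map₂ λ j f≤ rest≤ → begin
      seq (f 0) j + seq (sum {m} (λ i → f (suc (toℕ i)))) j ≤⟨ ℚ.+-mono-≤ f≤ rest≤ ⟩
      q 0 k + ½ * ε + (∑ℚ m (λ i → q (suc i) k) + ½ * ε)
        ≡⟨ trans (solve 3 (λ a b e → a :+ e :+ (b :+ e) := a :+ b :+ (e :+ e)) refl (q 0 k)
            (∑ℚ m (λ i → q (suc i) k)) (½ * ε))
                 (cong (λ r → q 0 k + ∑ℚ m (λ i → q (suc i) k) + r) (½*p+½*p≡p ε)) ⟩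
      q 0 k + ∑ℚ m (λ i → q (suc i) k) + ε ∎)
    (f≤q 0 (½ * ε) (0<½* 0<ε)) (sum-below {f ∘ suc} {q ∘ suc} (f≤q ∘ suc) m (½ * ε) (0<½* 0<ε))
    where open ℚ.≤-Reasoning

  -- Passage from the real hypotheses to integer estimates, and back to normality.

  module _ {b : ℕ} .{{_ : NonTrivial b}} {Ω : Set} (enum : Ω ↔ Fin b) (x : ℕ → Ω) (lam : ℝ) (M : ℕ → ℕ)
    (M-floor : ∀ k → IsFloor ((b ^ k) · lam) (M k)) where

    open Words enum

    private
      instance
        b≢0 : NonZero b
        b≢0 = ℕ.nonTrivial⇒nonZero b

    -- Take `Q` with `suc Q * ε ≥ 1` for a rational `ε` below `lam`. Then `b ^ k` is at most `suc Q`
    -- times `lam * b ^ k`, which is less than `suc Q * suc (M k)`.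
    b^k≤Q*M : 0ℝ ℝ.< lam → ∃ λ Q → ∀ k → b ^ k ℕ.≤ suc Q ℕ.* suc (M k)
    b^k≤Q*M (ε , 0<ε , ε≤lam) = Q , λ k → let
        j , ε≤lamⱼ , b^k*lam≤M = eventually-∃
            (eventually-map₂ (λ _ → _,_) ε≤lam (<⇒eventually-≤ ((b ^ k) · lam) (fromℕ (suc (M k)))
                (proj₂ (M-floor k))))
      in ℤ.drop‿+≤+ (ι-cancel-≤ (begin
        ι (+ (b ^ k))                          ≡⟨ ℚ.*-identityˡ (ι (+ (b ^ k))) ⟨
        1ℚ * ι (+ (b ^ k))                     ≤⟨ *-monoʳ (0≤ι (b ^ k)) 1≤Qε ⟩
        ι (+ suc Q) * ε * ι (+ (b ^ k))
            ≡⟨ solve 3 (λ Q e N → Q :* e :* N := Q :* (N :* (con 0ℚ :+ e))) refl (ι (+ suc Q)) ε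
                (ι (+ (b ^ k))) ⟩
        ι (+ suc Q) * (ι (+ (b ^ k)) * (0ℚ + ε)) ≤⟨ *-monoˡ (0≤ι (suc Q)) (*-monoˡ (0≤ι (b ^ k)) ε≤lamⱼ) ⟩
        ι (+ suc Q) * (ι (+ (b ^ k)) * seq lam j) ≡⟨ cong (λ r → ι (+ suc Q) * r) (seq-· (b ^ k) lam j) ⟨
        ι (+ suc Q) * seq ((b ^ k) · lam) j    ≤⟨ *-monoˡ (0≤ι (suc Q)) b^k*lam≤M ⟩
        ι (+ suc Q) * ι (+ suc (M k))          ≡⟨ ι-* (+ suc Q) (+ suc (M k)) ⟨
        ι (+ suc Q ℤ.* + suc (M k))            ≡⟨ cong ι (ℤ.pos-* (suc Q) (suc (M k))) ⟨
        ι (+ (suc Q ℕ.* suc (M k)))            ∎))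
      where
      open ℚ.≤-Reasoning
      Q = proj₁ (archimedean 0<ε)
      1≤Qε = proj₂ (archimedean 0<ε)

    module _ (p : ℕ → ℝ)
      (p-liminf : ∀ i → IsLiminf (λ k → Z x (M (suc k)) i (suc k)) (p i))
      (p-sum : IsSeriesSum (λ i → i · p i) lam) where

      -- No mass escapes: a partial sum of the series is already close to `lam`, its terms lie below
      -- the corresponding frequencies for large `k`, and the floor is at most `lam * b ^ suc k`.
      tightness : ∀ E → ∃ λ m → ∃ λ K → ∀ k → K ℕ.≤ k →
        + E ℤ.* (+ M (suc k) ℤ.- ∑ (upTo m) (λ i → + i ℤ.* + wordsOccurring enum x (M (suc k)) (suc k) i)) ℤ.≤
            + (b ^ suc k)
      -- Treated apart because the precision below is the reciprocal of `3 * E`.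
      tightness zero = 0 , 0 , λ k _ → ℤ.≤-trans (ℤ.≤-reflexive (ℤ.*-zeroˡ (+ M (suc k) ℤ.- 0ℤ))) (ℤ.+≤+ z≤n)
      tightness (suc E-1) = m , K , λ k K≤k → let
          N = b ^ suc k
          S = ∑ℚ m (λ i → q i k)
          T = ∑ (upTo m) (λ i → + i ℤ.* + wordsOccurring enum x (M (suc k)) (suc k) i)
          -- A single index `j` at which all three rational approximations are valid.
          j , (lam≤ , sum≤) , M≤ = eventually-∃ (eventually-map₂ (λ _ → _,_)
            (eventually-map₂ (λ _ → _,_) lam≤sum (sum≤S k K≤k))
            (proj₁ (M-floor (suc k)) δ 0<δ))
          instance N≢0 : NonZero N
                   N≢0 = ℕ.m^n≢0 b (suc k)
          -- One error `δ` comes from cutting the series, one from the lower limits and one from the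
          -- floor; the last is enlarged to `N * δ` using `N ≥ 1`.
          M≤T : ι (+ M (suc k)) ≤ ι T + + 3 / 1 * (ι (+ N) * δ)
          M≤T = begin
            ι (+ M (suc k))                  ≤⟨ M≤ ⟩
            seq (N · lam) j + δ              ≡⟨ cong (_+ δ) (seq-· N lam j) ⟩
            ι (+ N) * seq lam j + δ
                ≤⟨ ℚ.+-mono-≤ (*-monoˡ (0≤ι N) (ℚ.≤-trans lam≤ (ℚ.+-monoˡ-≤ δ sum≤)))
                    (ℚ.≤-trans (ℚ.≤-reflexive (sym (ℚ.*-identityˡ δ)))
                      (*-monoʳ (ℚ.<⇒≤ 0<δ) (ι-mono-≤ {1ℤ} (ℤ.+≤+ (ℕ.m^n>0 b (suc k)))))) ⟩
            ι (+ N) * (S + δ + δ) + ι (+ N) * δ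
              ≡⟨ solve 3 (λ N S d → N :* (S :+ d :+ d) :+ N :* d := S :* N :+ con (+ 3 / 1) :* (N :* d)) refl
                  (ι (+ N)) S δ ⟩
            S * ι (+ N) + + 3 / 1 * (ι (+ N) * δ)
              ≡⟨ cong (_+ + 3 / 1 * (ι (+ N) * δ)) (∑ℚ-ι m (ι (+ N)) λ i → trans
                  (ℚ.*-assoc (ι (+ i)) _ (ι (+ N)))
                   (trans (cong (λ r → ι (+ i) * r) (z/n*n≡z (+ wordsOccurring enum x (M (suc k)) (suc k) i) N))
                          (sym (ι-* (+ i) (+ wordsOccurring enum x (M (suc k)) (suc k) i))))) ⟩
            ι T + + 3 / 1 * (ι (+ N) * δ)    ∎
        in ι-cancel-≤ (begin
          ι (+ E ℤ.* (+ M (suc k) ℤ.- T))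
            ≡⟨ trans (ι-* (+ E) (+ M (suc k) ℤ.- T)) (cong (λ r → ι (+ E) * r) (ι-- (+ M (suc k)) T)) ⟩
          ι (+ E) * (ι (+ M (suc k)) - ι T)
            ≤⟨ *-monoˡ (0≤ι E) (ℚ.+-monoˡ-≤ (- ι T) M≤T) ⟩
          ι (+ E) * (ι T + + 3 / 1 * (ι (+ N) * δ) - ι T)
            ≡⟨ solve 4 (λ E T N d → E :* (T :+ con (+ 3 / 1) :* (N :* d) :- T) := d :* (con (+ 3 / 1) :* E) :* N)
                refl (ι (+ E)) (ι T) (ι (+ N)) δ ⟩
          δ * (ι (+ 3) * ι (+ E)) * ι (+ N)
            ≡⟨ cong (λ r → δ * r * ι (+ N)) (ι-* (+ 3) (+ E)) ⟨
          δ * ι (+ (3 ℕ.* E)) * ι (+ N)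
            ≡⟨ trans (cong (_* ι (+ N)) (recip-* D-1)) (ℚ.*-identityˡ (ι (+ N))) ⟩
          ι (+ N) ∎)
        where
        open ℚ.≤-Reasoning
        E = suc E-1
        -- `suc D-1` reduces to `3 * E`, so the three errors together amount to the reciprocal of
        -- `E`.
        D-1 = E-1 ℕ.+ 2 ℕ.* E
        δ = recip D-1
        0<δ = 0<recip D-1
        z q : ℕ → ℕ → ℚ
        z i k = wordsOccurring enum x (M (suc k)) (suc k) i /b^ suc k
        q i k = ι (+ i) * z i k
        m = proj₁ (p-sum (fromℚ δ) (fromℚ-pos 0<δ))
        s = sum {m} (λ i → toℕ i · p (toℕ i))
        lam≤sum : Eventually (λ j → seq lam j ≤ seq s j + δ)
        lam≤sum = eventually-map (λ j → ∣p-q∣≤r⇒q≤p+r (seq s j) (seq lam j))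
          (<⇒eventually-≤ ℝ.∣ s ℝ.- lam ∣ (fromℚ δ) (proj₂ (p-sum (fromℚ δ) (fromℚ-pos 0<δ)) m ℕ.≤-refl))
        below = sum-below {λ i → i · p i} {q}
            (λ i → ·-below i {p i} {z i} (liminf-below {z i} {p i} (p-liminf i))) m δ 0<δ
        K = proj₁ below
        sum≤S = proj₂ below

    -- Multiplying by `E * n * p` leaves the integer estimate, and `n ≤ n * p` because `p ≥ 1`.
    ∣a/n-1/p∣≤ : ∀ a n p E .{{_ : NonZero n}} .{{_ : NonZero p}} .{{_ : NonZero E}} {h} → 1ℚ ≤ ι (+ E) * h →
      + E ℤ.* ‖ + p ℤ.* + a ℤ.- + n ‖ ℤ.≤ + n → ∣ + a / n - 1ℤ / p ∣ ≤ h
    ∣a/n-1/p∣≤ a n p E {h} 1≤Eh ≤n = ℚ.*-cancelʳ-≤-pos (ι (+ E) * np)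
        {{ℚ.positive (*-pos {ι (+ E)} (0<ι E) 0<np)}} (begin
      ∣ q ∣ * (ι (+ E) * np)
          ≡⟨ solve 3 (λ q E r → q :* (E :* r) := E :* (q :* r)) refl ∣ q ∣ (ι (+ E)) np ⟩
      ι (+ E) * (∣ q ∣ * np)             ≡⟨ cong (λ r → ι (+ E) * r) ∣q∣*np≡ ⟩
      ι (+ E) * ι ‖ D ‖                  ≡⟨ ι-* (+ E) ‖ D ‖ ⟨
      ι (+ E ℤ.* ‖ D ‖)                  ≤⟨ ι-mono-≤ ≤n ⟩
      ι (+ n)                            ≡⟨ trans (ℚ.*-identityˡ (ι (+ n) * 1ℚ)) (ℚ.*-identityʳ (ι (+ n))) ⟨
      1ℚ * (ι (+ n) * 1ℚ)
          ≤⟨ *-monoʳ (subst (0ℚ ≤_) (sym (ℚ.*-identityʳ (ι (+ n)))) (0≤ι n)) 1≤Eh ⟩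
      ι (+ E) * h * (ι (+ n) * 1ℚ)
          ≤⟨ *-monoˡ (ℚ.≤-trans (*≤* (ℤ.+≤+ z≤n)) 1≤Eh)
              (*-monoˡ (0≤ι n) (ι-mono-≤ {1ℤ} {+ p} (ℤ.+≤+ (ℕ.>-nonZero⁻¹ p)))) ⟩
      ι (+ E) * h * np
          ≡⟨ solve 3 (λ E h r → E :* h :* r := h :* (E :* r)) refl (ι (+ E)) h np ⟩
      h * (ι (+ E) * np)                 ∎)
      where
      open ℚ.≤-Reasoning
      np = ι (+ n) * ι (+ p)
      q = + a / n - 1ℤ / p
      D = + p ℤ.* + a ℤ.- + n
      0<np = *-pos {ι (+ n)} {ι (+ p)} (0<ι n) (0<ι p)
      q*np≡ : q * np ≡ ι D
      q*np≡ = trans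
        (solve 4 (λ a c n p → (a :- c) :* (n :* p) := a :* n :* p :- c :* p :* n) refl (+ a / n) (1ℤ / p)
            (ι (+ n)) (ι (+ p)))
        (trans (cong₂ (λ r s → r * ι (+ p) - s * ι (+ n)) (z/n*n≡z (+ a) n) (z/n*n≡z 1ℤ p))
        (trans (cong₂ _-_ (trans (ℚ.*-comm (ι (+ a)) (ι (+ p))) (sym (ι-* (+ p) (+ a))))
            (ℚ.*-identityˡ (ι (+ n))))
               (sym (ι-- (+ p ℤ.* + a) (+ n)))))
      ∣q∣*np≡ : ∣ q ∣ * np ≡ ι ‖ D ‖
      ∣q∣*np≡ = trans (cong (λ r → ∣ q ∣ * r) (sym (ℚ.0≤p⇒∣p∣≡p (ℚ.<⇒≤ 0<np))))
        (trans (sym (ℚ.∣p*q∣≡∣p∣*∣q∣ q np)) (trans (cong ∣_∣ q*np≡) (∣ι∣ D)))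

    borelNormal : (∀ w E → ∃ λ N → ∀ n → N ℕ.≤ n →
        + E ℤ.* ‖ + (b ^ length w) ℤ.* + occurrences w (applyUpTo x n) ℤ.- + n ‖ ℤ.≤ + n) →
      BorelNormal x
    borelNormal equidistributed w ε (ε′ , 0<ε′ , J , ε′≤ε) = N , λ n N≤n →
      -- Half of `ε′` bounds the error; the other half is the margin that strict inequality of reals
      -- demands.
      ½ * ε′ , 0<½* 0<ε′ , J , λ j J≤j → begin
        ∣ + occurrences w (applyUpTo x (suc n)) / suc n - 1 /b^ length w ∣ + ½ * ε′
          ≤⟨ ℚ.+-monoˡ-≤ (½ * ε′) (∣a/n-1/p∣≤ (occurrences w (applyUpTo x (suc n))) (suc n) (b ^ length w) E
               {{_}} {{ℕ.m^n≢0 b (length w)}} 1≤Eh (bound (suc n) (ℕ.≤-trans N≤n (ℕ.n≤1+n n)))) ⟩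
        ½ * ε′ + ½ * ε′    ≡⟨ trans (½*p+½*p≡p ε′) (sym (ℚ.+-identityˡ ε′)) ⟩
        0ℚ + ε′            ≤⟨ ε′≤ε j J≤j ⟩
        seq ε j            ∎
      where
      open ℚ.≤-Reasoning
      E = suc (proj₁ (archimedean (0<½* 0<ε′)))
      1≤Eh = proj₂ (archimedean (0<½* 0<ε′))
      N = proj₁ (equidistributed w E)
      bound = proj₂ (equidistributed w E)

open import Defs

theorem2 : ∀ (b : ℕ) .{{_ : NonTrivial b}} (Ω : Set) (enum : Ω ↔ Fin b)
    (x : ℕ → Ω) (lam : ℝ) → 0ℝ < lam →
    (⌊lam*b^_⌋ : ℕ → ℕ) → (∀ k → IsFloor ((b ^ k) · lam) (⌊lam*b^ k ⌋)) →
    (p : ℕ → ℝ) →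
    (∀ i → IsLiminf (λ k → Words.Z enum x (⌊lam*b^ suc k ⌋) i (suc k)) (p i)) →
    IsSeriesSum (λ i → i · p i) lam →
    Words.BorelNormal enum x
theorem2 b Ω enum x lam 0<lam ⌊lam*b^_⌋ isFloor p p-liminf p-sum =
  Limits.borelNormal enum x lam ⌊lam*b^_⌋ isFloor
    (Counting.occurrences-equidistributed enum x ⌊lam*b^_⌋ (proj₁ growth) (proj₂ growth)
      (Limits.tightness enum x lam ⌊lam*b^_⌋ isFloor p p-liminf p-sum))
  where growth = Limits.b^k≤Q*M enum x lam ⌊lam*b^_⌋ isFloor 0<lam
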